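{- Let $p$ be a prime and $m\geqslant1$. The number of distinct (modulo $x^{p^m}-x$) Costas polynomials over $\mathbb{F}_{p^m}$ of the form $L(x^s)$, where $L(x)\in\mathbb{F}_{p^m}[x]$ is a linearized permutation polynomial and $s$ is a positive integer with $\gcd(s,p^m-1)=1$, is $$\frac{\phi(p^m-1)}{m}\prod_{k=0}^{m-1}(p^m-p^k),$$ where $\phi$ is Euler's totient function.
   Context: Let $q=p^m$. A linearized permutation polynomial over $\mathbb{F}_q$ is a polynomial $L(x)=\sum_{j=0}^{m-1}c_jx^{p^j}\in\mathbb{F}_q[x]$ inducing a permutation of $\mathbb{F}_q$. A Costas polynomial is a polynomial $f\in\mathbb{F}_q[x]$ with $f(0)=0$ such that $x\mapsto f(dx)-f(x)$ is a permutation of $\mathbb{F}_q$ for every $d\in\mathbb{F}_q$, $d\neq1$. -}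

module Defs where

open import Level using (0ℓ)
open import Data.Nat as ℕ using (ℕ; zero; suc)
open import Data.Nat.GCD using (gcd)
open import Data.Fin using (Fin)
open import Data.List using (List; length; filter; map; upTo)
open import Data.Product using (Σ; ∃; _×_; _,_)
open import Relation.Binary.PropositionalEquality using (_≡_; _≢_)
open import Algebra.Structures using (IsCommutativeRing)
open import Function.Bundles using (_↔_)

φ : ℕ → ℕ
φ n = length (filter (λ k → gcd k n ℕ.≟ 1) (map suc (upTo n)))

prod : ℕ → (ℕ → ℕ) → ℕ
prod zero    f = 1
prod (suc n) f = prod n f ℕ.* f n

record FiniteField (q : ℕ) : Set₁ where
  infixl 6 _+_ _-_
  infixl 7 _*_
  field
    Carrier : Set
    _+_ _*_ : Carrier → Carrier → Carrier
    -_      : Carrier → Carrier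
    0# 1#   : Carrier
    isCommutativeRing : IsCommutativeRing _≡_ _+_ _*_ -_ 0# 1#
    0≢1     : 0# ≢ 1#
    inverse : ∀ x → x ≢ 0# → ∃ λ y → x * y ≡ 1#
    enumeration : Fin q ↔ Carrier

  _-_ : Carrier → Carrier → Carrier
  x - y = x + (- y)

  _^_ : Carrier → ℕ → Carrier
  x ^ zero  = 1#
  x ^ suc n = x * (x ^ n)

  sumF : (n : ℕ) → (ℕ → Carrier) → Carrier
  sumF zero    f = 0#
  sumF (suc n) f = sumF n f + f n

  IsPermutation : (Carrier → Carrier) → Set
  IsPermutation f = (∀ x y → f x ≡ f y → x ≡ y) × (∀ y → ∃ λ x → f x ≡ y)

  linearized : (p m : ℕ) → (ℕ → Carrier) → Carrier → Carrier
  linearized p m c x = sumF m (λ j → c j * (x ^ (p ℕ.^ j)))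

  -- Costas polynomial (as a function F_q → F_q, i.e. modulo x^q - x)
  IsCostas : (Carrier → Carrier) → Set
  IsCostas f = (f 0# ≡ 0#) × (∀ d → d ≢ 1# → IsPermutation (λ x → f (d * x) - f x))

  IsLinOfPower : (p m : ℕ) → (Carrier → Carrier) → Set
  IsLinOfPower p m f =
    Σ (ℕ → Carrier) λ c → Σ ℕ λ s →
      IsPermutation (linearized p m c) × (1 ℕ.≤ s) × (gcd s (q ℕ.∸ 1) ≡ 1) ×
      (∀ x → f x ≡ linearized p m c (x ^ s))

  IsCostasLinOfPower : (p m : ℕ) → (Carrier → Carrier) → Set
  IsCostasLinOfPower p m f = IsCostas f × IsLinOfPower p m f

{-# OPTIONS --safe #-}
module Submission where

-- Write n = q - 1. A composition L(x^s) with L additive and bijective and s prime to n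
-- is always a Costas map, because f(dx) - f(x) = L((d^s - 1) x^s); so it remains to count
-- the maps L(x^s).
--
-- A linearized polynomial is determined by its map, since its degree is below q. As the
-- coefficient vectors and the images of a basis over the prime field are equally many, every
-- additive map is linearized, and the permutations among them correspond to the independent
-- m-tuples, of which there are ∏ (q - pᵏ).
--
-- The exponent may be taken modulo n, and replacing s by s p only composes L with Frobenius.
-- Conversely, if L(x^r) = L'(x^s) then L'⁻¹ L is additive, so x^s is a combination of the
-- monomials x^(r pʲ), and comparing coefficients puts s in the orbit of r under p. This
-- leaves one exponent for each orbit of the units modulo n under multiplication by p, and
-- these orbits all have m elements, since 1, p, …, pᵐ⁻¹ are distinct modulo n.

open import Defs
open import Level using (0ℓ)
open import Algebra.Bundles using (CommutativeMonoid; CommutativeRing)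
import Algebra.Properties.CommutativeMonoid.Mult as Mult
import Algebra.Properties.CommutativeSemigroup as CommutativeSemigroup
import Algebra.Properties.CommutativeSemiring.Binomial as Binomial
import Algebra.Properties.CommutativeSemiring.Exp as CommExp
import Algebra.Properties.Ring as RingProperties
import Algebra.Properties.Semiring.Binomial as BinomialTerms
import Algebra.Properties.Semiring.Exp as Exp
import Algebra.Properties.Semiring.Mult as SemiringMult
import Algebra.Properties.Semiring.Sum as Sum
import Algebra.Solver.Ring.NaturalCoefficients.Default as RingSolver
open import Data.Empty using (⊥-elim)
open import Data.Fin as Fin using (Fin; toℕ; fromℕ; inject₁)
import Data.Fin.Properties as Finₚ
open import Data.List using (List; []; _∷_; _++_; length; map; filter; foldr; concatMap; upTo; allFin; cartesianProduct; cartesianProductWith; deduplicate)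
import Data.List.Properties as List
open import Data.List.Membership.Propositional using (_∈_; _∉_; find; lose)
open import Data.List.Membership.Propositional.Properties using (∈-map⁺; ∈-map⁻; ∈-filter⁺; ∈-filter⁻; ∈-++⁺ˡ; ∈-++⁺ʳ; ∈-upTo⁺; ∈-upTo⁻; ∈-allFin; ∈-cartesianProduct⁺; ∈-cartesianProduct⁻; ∈-cartesianProductWith⁺; ∈-concatMap⁺; ∈-concatMap⁻; ∈-deduplicate⁻)
open import Data.List.Membership.Propositional.Properties.WithK using (unique∧set⇒bag)
open import Data.List.Relation.Binary.BagAndSetEquality using (∼bag⇒↭)
open import Data.List.Relation.Binary.Disjoint.Propositional using (Disjoint)
open import Data.List.Relation.Binary.Permutation.Propositional using (_↭_; ↭⇒↭ₛ′)
open import Data.List.Relation.Binary.Permutation.Propositional.Properties using (↭-length)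
open import Data.List.Relation.Binary.Permutation.Setoid.Properties using (foldr-commMonoid)
open import Data.List.Relation.Unary.All as All using (All; []; _∷_)
import Data.List.Relation.Unary.All.Properties as Allₚ
open import Data.List.Relation.Unary.AllPairs as AllPairs using (AllPairs; []; _∷_)
open import Data.List.Relation.Unary.Any using (Any; here; there)
import Data.List.Relation.Unary.Any.Properties as Anyₚ
open import Data.List.Relation.Unary.Unique.Propositional using (Unique)
import Data.List.Relation.Unary.Unique.DecSetoid.Properties as DecUnique
import Data.List.Relation.Unary.Unique.Propositional.Properties as Unique
open import Data.Nat as ℕ using (ℕ; zero; suc; _≤_; _<_; z≤n; s≤s; NonZero; >-nonZero; ≢-nonZero⁻¹)
import Data.Nat.Properties as ℕₚ
open import Data.Nat.Combinatorics using (_C_; nCn≡1; nC1≡n; nCk+nC[k+1]≡[n+1]C[k+1])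
open import Data.Nat.Coprimality using (Coprime; coprime⇒gcd≡1; gcd≡1⇒coprime; coprime-divisor; coprime-Bézout; prime⇒coprime) renaming (sym to coprime-sym)
open import Data.Nat.DivMod using (%-distribˡ-*; %-remove-+ʳ; m%n%n≡m%n; n%n≡0; m%n<n; m<n⇒m%n≡m; m≡m%n+[m/n]*n; [m+n]%n≡m%n; m*n/n≡m)
open import Data.Nat.Divisibility using (_∣_; divides; ∣-trans; m∣m*n; ∣⇒≤; ∣m+n∣m⇒∣n; ∣1⇒≡1; %-presˡ-∣; ∣n∣m%n⇒∣m)
open import Data.Nat.GCD using (gcd; module Bézout)
open import Data.Nat.Primality using (Prime; euclidsLemma; prime⇒nonTrivial)
open import Data.Product using (Σ; ∃; _×_; _,_; proj₁; proj₂)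
open import Data.Sum using (inj₁; inj₂; [_,_]′)
open import Data.Unit using (⊤; tt)
open import Data.Vec as Vec using (Vec; []; _∷_)
import Data.Vec.Properties as Vecₚ
open import Data.Vec.Relation.Unary.All as VAll using ([]; _∷_)
open import Function using (_∘_; Inverse; Injection; mk⇔)
open import Function.Properties.Inverse using (Inverse⇒Injection; ↔-sym)
open import Relation.Binary using (DecSetoid; DecidableEquality; Decidable; Symmetric; Transitive; tri<; tri≈; tri>)
open import Relation.Binary.PropositionalEquality using (_≡_; _≢_; refl; sym; trans; cong; cong₂; subst; module ≡-Reasoning)
open import Relation.Nullary using (¬_; yes; no; ¬?)

-- Lists without repetition and counting in finite sets.

module _ {A : Set} where

  Enumerates : List A → Set
  Enumerates xs = Unique xs × (∀ x → x ∈ xs)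

  -- Without repetitions every multiplicity is 0 or 1, so mutual inclusion fixes a list up to order.
  -- Lengths and folds are compared through this.
  unique-↭ : ∀ {xs ys : List A} → Unique xs → Unique ys →
             (∀ {x} → x ∈ xs → x ∈ ys) → (∀ {x} → x ∈ ys → x ∈ xs) → xs ↭ ys
  unique-↭ ux uy f g = ∼bag⇒↭ (unique∧set⇒bag ux uy (mk⇔ f g))

  ∈-AllPairs⇒≡ : ∀ {xs : List A} {R : A → A → Set} → Symmetric R →
                 AllPairs (λ x y → ¬ R x y) xs →
                 ∀ {x y} → x ∈ xs → y ∈ xs → R x y → x ≡ y
  ∈-AllPairs⇒≡ s (_ ∷ _)  (here refl) (here refl) r = refl
  ∈-AllPairs⇒≡ s (px ∷ _) (here refl) (there y∈)  r = ⊥-elim (All.lookup px y∈ r)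
  ∈-AllPairs⇒≡ s (px ∷ _) (there x∈)  (here refl) r = ⊥-elim (All.lookup px x∈ (s r))
  ∈-AllPairs⇒≡ s (_ ∷ ps) (there x∈)  (there y∈)  r = ∈-AllPairs⇒≡ s ps x∈ y∈ r

  -- The membership arguments let the passage from `P` to `Q` use facts that hold only for members
  -- of the list, such as being an orbit representative.
  AllPairs-map⁺ : ∀ {B : Set} {f : A → B} {P : A → A → Set} {Q : B → B → Set} {xs} →
                  (∀ {x y} → x ∈ xs → y ∈ xs → P x y → Q (f x) (f y)) →
                  AllPairs P xs → AllPairs Q (map f xs)
  AllPairs-map⁺ h [] = []
  AllPairs-map⁺ h (px ∷ ps) =
    Allₚ.map⁺ (All.tabulate (λ y∈ → h (here refl) (there y∈) (All.lookup px y∈))) ∷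
    AllPairs-map⁺ (λ x∈ y∈ → h (there x∈) (there y∈)) ps

  length-concatMap : ∀ {B : Set} (g : A → List B) {c} xs →
                     (∀ {x} → x ∈ xs → length (g x) ≡ c) →
                     length (concatMap g xs) ≡ length xs ℕ.* c
  length-concatMap g []       h = refl
  length-concatMap g (x ∷ xs) h = trans (List.length-++ (g x))
    (cong₂ ℕ._+_ (h (here refl)) (length-concatMap g xs (h ∘ there)))

module _ {A : Set} (_≟_ : DecidableEquality A) where

  open import Data.List.Membership.DecPropositional _≟_ using (_∈?_)

  -- The list `ys` followed by the filtered list is a rearrangement of `xs`.
  length-filter-∉ : ∀ {xs ys : List A} → Enumerates xs → Unique ys →
                    length (filter (λ x → ¬? (x ∈? ys)) xs) ≡ length xs ℕ.∸ length ys
  length-filter-∉ {xs} {ys} (ux , cx) uy = sym (trans (cong (ℕ._∸ length ys) len) (ℕₚ.m+n∸m≡n (length ys) _))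
    where
    zs = filter (λ x → ¬? (x ∈? ys)) xs
    into : ∀ {x} → x ∈ xs → x ∈ ys ++ zs
    into {x} x∈ with x ∈? ys
    ... | yes x∈ys = ∈-++⁺ˡ x∈ys
    ... | no  x∉ys = ∈-++⁺ʳ ys (∈-filter⁺ (λ x → ¬? (x ∈? ys)) x∈ x∉ys)
    uyz : Unique (ys ++ zs)
    uyz = Unique.++⁺ uy (Unique.filter⁺ _ ux)
            (λ (x∈ys , x∈zs) → proj₂ (∈-filter⁻ (λ x → ¬? (x ∈? ys)) {xs = xs} x∈zs) x∈ys)
    len : length xs ≡ length ys ℕ.+ length zs
    len = trans (↭-length (unique-↭ ux uyz into (λ _ → cx _))) (List.length-++ ys)

  length-≤ : ∀ {xs ys : List A} → Enumerates xs → Unique ys → length ys ≤ length xs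
  length-≤ {xs} {ys} (ux , cx) uy = subst (_≤ length xs) (↭-length p) (List.length-filter (_∈? ys) xs)
    where
    p : filter (_∈? ys) xs ↭ ys
    p = unique-↭ (Unique.filter⁺ _ ux) uy
          (λ x∈ → proj₂ (∈-filter⁻ (_∈? ys) {xs = xs} x∈)) (λ x∈ → ∈-filter⁺ (_∈? ys) (cx _) x∈)

  -- Pigeonhole: a missed value `y` put in front of `map f xs` would give a list without repetition
  -- that is longer than `xs`.
  injective⇒surjective : ∀ {xs : List A} → Enumerates xs → {f : A → A} →
                         (∀ {x y} → f x ≡ f y → x ≡ y) → ∀ y → ∃ λ x → f x ≡ y
  injective⇒surjective {xs} en {f} inj y with y ∈? map f xs
  ... | yes y∈ = let x , _ , eq = ∈-map⁻ f y∈ in x , sym eq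
  ... | no  y∉ = ⊥-elim (ℕₚ.<-irrefl refl
      (subst (_< length xs) (List.length-map f xs)
        (length-≤ en (All.tabulate (λ z∈ eq → y∉ (subst (_∈ _) (sym eq) z∈)) ∷ Unique.map⁺ inj (proj₁ en)))))

  -- A choice of preimages is injective, hence surjective by the previous lemma. So every point is a
  -- chosen preimage, and `f` separates those.
  surjective⇒injective : ∀ {xs : List A} → Enumerates xs → {f : A → A} →
                         (∀ y → ∃ λ x → f x ≡ y) → ∀ {x y} → f x ≡ f y → x ≡ y
  surjective⇒injective en {f} sur {x} {y} eq
    with injective⇒surjective en {λ z → proj₁ (sur z)} (λ e → trans (sym (proj₂ (sur _))) (trans (cong f e) (proj₂ (sur _)))) x
       | injective⇒surjective en {λ z → proj₁ (sur z)} (λ e → trans (sym (proj₂ (sur _))) (trans (cong f e) (proj₂ (sur _)))) y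
  ... | x′ , refl | y′ , refl = cong (λ z → proj₁ (sur z)) (trans (sym (proj₂ (sur x′))) (trans eq (proj₂ (sur y′))))

length-cartesianProductWith : ∀ {A B C : Set} (f : A → B → C) xs ys →
                              length (cartesianProductWith f xs ys) ≡ length xs ℕ.* length ys
length-cartesianProductWith f []       ys = refl
length-cartesianProductWith f (x ∷ xs) ys = trans (List.length-++ (map (f x) ys))
  (cong₂ ℕ._+_ (List.length-map (f x) ys) (length-cartesianProductWith f xs ys))

vecs : {A : Set} → List A → (k : ℕ) → List (Vec A k)
vecs xs zero    = [] ∷ []
vecs xs (suc k) = cartesianProductWith _∷_ xs (vecs xs k)

vecs-enumerates : ∀ {A : Set} {xs : List A} → Enumerates xs → ∀ k → Enumerates (vecs xs k)
vecs-enumerates en zero = ([] ∷ []) , λ { [] → here refl }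
vecs-enumerates en@(u , c) (suc k) =
  Unique.cartesianProductWith⁺ _∷_ Vecₚ.∷-injective u (proj₁ (vecs-enumerates en k)) ,
  λ { (x ∷ v) → ∈-cartesianProductWith⁺ _∷_ (c x) (proj₂ (vecs-enumerates en k) v) }

length-vecs : ∀ {A : Set} (xs : List A) k → length (vecs xs k) ≡ length xs ℕ.^ k
length-vecs xs zero    = refl
length-vecs xs (suc k) = trans (length-cartesianProductWith _∷_ xs (vecs xs k)) (cong (length xs ℕ.*_) (length-vecs xs k))

-- Arithmetic modulo `n`.

module Residues (n : ℕ) .{{_ : NonZero n}} where

  open import Data.Nat using (_+_; _*_; _∸_; _/_; _%_; _≟_)

  infix 4 _≡ₙ_
  _≡ₙ_ : ℕ → ℕ → Set
  a ≡ₙ b = a % n ≡ b % n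

  *-congₙ : ∀ {a b c d} → a ≡ₙ b → c ≡ₙ d → a * c ≡ₙ b * d
  *-congₙ {a} {b} {c} {d} e f = begin
    a * c % n               ≡⟨ %-distribˡ-* a c n ⟩
    (a % n) * (c % n) % n   ≡⟨ cong₂ (λ x y → x * y % n) e f ⟩
    (b % n) * (d % n) % n   ≡⟨ %-distribˡ-* b d n ⟨
    b * d % n               ∎
    where open ≡-Reasoning

  -- The common remainder cancels, leaving the difference of the quotients times `n`; for `b < a`
  -- both differences are truncated to zero.
  ≡ₙ⇒∣∸ : ∀ {a b} → a ≡ₙ b → n ∣ b ∸ a
  ≡ₙ⇒∣∸ {a} {b} e = divides (b / n ∸ a / n) (begin
    b ∸ a                                       ≡⟨ cong₂ _∸_ (m≡m%n+[m/n]*n b n) (m≡m%n+[m/n]*n a n) ⟩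
    b % n + b / n * n ∸ (a % n + a / n * n)     ≡⟨ cong (λ r → b % n + b / n * n ∸ (r + a / n * n)) e ⟩
    b % n + b / n * n ∸ (b % n + a / n * n)     ≡⟨ ℕₚ.[m+n]∸[m+o]≡n∸o (b % n) _ _ ⟩
    b / n * n ∸ a / n * n                       ≡⟨ ℕₚ.*-distribʳ-∸ n (b / n) (a / n) ⟨
    (b / n ∸ a / n) * n                         ∎)
    where open ≡-Reasoning

  -- For `b ≤ c`, `n` divides `a * (c ∸ b)` and is coprime to `a`, so it divides `c ∸ b`; the other
  -- order is symmetric.
  cancelₙ : ∀ {a b c} → Coprime a n → a * b ≡ₙ a * c → b ≡ₙ c
  cancelₙ {a} cop e = [ (λ b≤c → go b≤c e) , (λ c≤b → sym (go c≤b (sym e))) ]′ (ℕₚ.≤-total _ _)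
    where
    go : ∀ {b c} → b ≤ c → a * b ≡ₙ a * c → b ≡ₙ c
    go {b} {c} b≤c e = sym (trans (cong (_% n) (sym (ℕₚ.m+[n∸m]≡n b≤c)))
      (%-remove-+ʳ b (coprime-divisor (coprime-sym cop)
        (subst (n ∣_) (sym (ℕₚ.*-distribˡ-∸ a c b)) (≡ₙ⇒∣∸ e)))))

  coprime-resp : ∀ {a b} → a ≡ₙ b → Coprime a n → Coprime b n
  coprime-resp e cop (d∣b , d∣n) =
    cop (∣n∣m%n⇒∣m d∣n (subst (_ ∣_) (sym e) (%-presˡ-∣ d∣b d∣n)) , d∣n)

  coprime-* : ∀ {a b} → Coprime a n → Coprime b n → Coprime (a * b) n
  coprime-* {a} ca cb (d∣ab , d∣n) =
    cb (coprime-divisor (λ (e∣d , e∣a) → ca (e∣a , ∣-trans e∣d d∣n)) d∣ab , d∣n)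

  -- The representative of a residue class in 1 … n (rather than 0 … n - 1):
  -- exponents must stay positive, since 0 ^ 0 = 1.
  positive : ℕ → ℕ
  positive zero    = n
  positive (suc r) = suc r

  red : ℕ → ℕ
  red a = positive (a % n)

  red-cong : ∀ {a b} → a ≡ₙ b → red a ≡ red b
  red-cong = cong positive

  red-≡ₙ : ∀ a → red a ≡ₙ a
  red-≡ₙ a with a % n in eq
  ... | zero  = n%n≡0 n
  ... | suc r = trans (cong (_% n) (sym eq)) (trans (m%n%n≡m%n a n) eq)

  0<red : ∀ a → 0 < red a
  0<red a with a % n
  ... | zero  = ℕₚ.n≢0⇒n>0 (≢-nonZero⁻¹ n)
  ... | suc r = s≤s z≤n

  red≤n : ∀ a → red a ≤ n
  red≤n a with a % n | m%n<n a n
  ... | zero  | _  = ℕₚ.≤-refl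
  ... | suc r | lt = ℕₚ.<⇒≤ lt

  red-id : ∀ {a} → 0 < a → a ≤ n → red a ≡ a
  red-id {a} 0<a a≤n with a ≟ n
  ... | yes refl = cong positive (n%n≡0 n)
  red-id {suc a} 0<a a≤n | no a≢n = cong positive (m<n⇒m%n≡m (ℕₚ.≤∧≢⇒< a≤n a≢n))

-- Orbits of the units modulo `n` under multiplication by `p`.

module Orbits (p m n : ℕ) .{{_ : NonZero m}} .{{_ : NonZero n}} (1<p : 1 < p) (pᵐ≡1+n : p ℕ.^ m ≡ suc n) where

  open import Data.Nat using (_+_; _*_; _∸_; _^_; _/_; _%_; _≟_)
  open Residues n

  instance
    p≢0 : NonZero p
    p≢0 = >-nonZero (ℕₚ.<-trans (s≤s z≤n) 1<p)

  -- A common divisor divides both `p ^ m = 1 + n` and `n`, hence 1.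
  coprime-p : Coprime p n
  coprime-p {d} (d∣p , d∣n) = ∣1⇒≡1 (∣m+n∣m⇒∣n (subst (d ∣_) (trans pᵐ≡1+n (ℕₚ.+-comm 1 n)) (d∣pᵐ m)) d∣n)
    where
    d∣pᵐ : ∀ k .{{_ : NonZero k}} → d ∣ p ^ k
    d∣pᵐ (suc k) = ∣-trans d∣p (m∣m*n (p ^ k))

  coprime-p^ : ∀ k → Coprime (p ^ k) n
  coprime-p^ zero    (d∣1 , _) = ∣1⇒≡1 d∣1
  coprime-p^ (suc k) = coprime-* coprime-p (coprime-p^ k)

  pᵐ≡ₙ1 : p ^ m ≡ₙ 1
  pᵐ≡ₙ1 = trans (cong (_% n) pᵐ≡1+n) ([m+n]%n≡m%n 1 n)

  p^-periodic : ∀ k → p ^ k ≡ₙ p ^ (k % m)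
  p^-periodic k = begin
    p ^ k % n                              ≡⟨ cong (λ e → p ^ e % n) (m≡m%n+[m/n]*n k m) ⟩
    p ^ (k % m + k / m * m) % n            ≡⟨ cong (_% n) (ℕₚ.^-distribˡ-+-* p (k % m) _) ⟩
    p ^ (k % m) * p ^ (k / m * m) % n      ≡⟨ *-congₙ {p ^ (k % m)} refl (multiples (k / m)) ⟩
    p ^ (k % m) * 1 % n                    ≡⟨ cong (_% n) (ℕₚ.*-identityʳ _) ⟩
    p ^ (k % m) % n                        ∎
    where
    open ≡-Reasoning
    multiples : ∀ j → p ^ (j * m) ≡ₙ 1
    multiples zero    = refl
    multiples (suc j) = trans (cong (_% n) (ℕₚ.^-distribˡ-+-* p m (j * m))) (*-congₙ pᵐ≡ₙ1 (multiples j))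

  p^-injective : ∀ {i j} → p ^ i ≡ p ^ j → i ≡ j
  p^-injective {i} {j} e with ℕₚ.<-cmp i j
  ... | tri≈ _ i≡j _ = i≡j
  ... | tri< i<j _ _ = ⊥-elim (ℕₚ.<-irrefl e (ℕₚ.^-monoʳ-< p 1<p i<j))
  ... | tri> _ _ j<i = ⊥-elim (ℕₚ.<-irrefl (sym e) (ℕₚ.^-monoʳ-< p 1<p j<i))

  p^≤n : ∀ {i} → i < m → p ^ i ≤ n
  p^≤n {i} i<m = ℕₚ.<⇒≤pred (subst (p ^ i <_) pᵐ≡1+n (ℕₚ.^-monoʳ-< p 1<p i<m))

  -- The powers in question lie between 1 and `n`, so each is its own representative under `red`,
  -- and congruence becomes equality. This gives every orbit its full size `m`.
  p^-injectiveₙ : ∀ {i j} → i < m → j < m → p ^ i ≡ₙ p ^ j → i ≡ j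
  p^-injectiveₙ {i} {j} i<m j<m e = p^-injective
    (trans (sym (red-id (ℕₚ.m^n>0 p i) (p^≤n i<m))) (trans (red-cong e) (red-id (ℕₚ.m^n>0 p j) (p^≤n j<m))))

  infix 4 _~_
  -- The bound on `k` makes the relation decidable by search; it costs no generality, because
  -- `p ^ m` is 1 modulo `n`.
  _~_ : ℕ → ℕ → Set
  s ~ t = ∃ λ k → k < m × s * p ^ k ≡ₙ t

  ~-intro : ∀ s {t} k → s * p ^ k ≡ₙ t → s ~ t
  ~-intro s k e = k % m , m%n<n k m , trans (*-congₙ {s} refl (sym (p^-periodic k))) e

  -- The inverse of `p ^ k` modulo `n` is `p ^ (m ∸ k)`.
  ~-sym : Symmetric _~_
  ~-sym {s} {t} (k , k<m , e) = ~-intro t (m ∸ k) (begin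
    t * p ^ (m ∸ k) % n              ≡⟨ *-congₙ (sym e) refl ⟩
    s * p ^ k * p ^ (m ∸ k) % n      ≡⟨ cong (_% n) (ℕₚ.*-assoc s (p ^ k) _) ⟩
    s * (p ^ k * p ^ (m ∸ k)) % n    ≡⟨ cong (λ e → s * e % n) (ℕₚ.^-distribˡ-+-* p k (m ∸ k)) ⟨
    s * p ^ (k + (m ∸ k)) % n        ≡⟨ cong (λ e → s * p ^ e % n) (ℕₚ.m+[n∸m]≡n (ℕₚ.<⇒≤ k<m)) ⟩
    s * p ^ m % n                    ≡⟨ *-congₙ {s} refl pᵐ≡ₙ1 ⟩
    s * 1 % n                        ≡⟨ cong (_% n) (ℕₚ.*-identityʳ s) ⟩
    s % n                            ∎)
    where open ≡-Reasoning

  ~-trans : Transitive _~_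
  ~-trans {s} {t} {u} (k , _ , e) (l , _ , f) = ~-intro s (k + l) (begin
    s * p ^ (k + l) % n      ≡⟨ cong (λ e → s * e % n) (ℕₚ.^-distribˡ-+-* p k l) ⟩
    s * (p ^ k * p ^ l) % n  ≡⟨ cong (_% n) (ℕₚ.*-assoc s (p ^ k) _) ⟨
    s * p ^ k * p ^ l % n    ≡⟨ *-congₙ e refl ⟩
    t * p ^ l % n            ≡⟨ f ⟩
    u % n                    ∎)
    where open ≡-Reasoning

  _~?_ : Decidable _~_
  s ~? t = ℕₚ.anyUpTo? (λ k → s * p ^ k % n ≟ t % n) m

  ~-decSetoid : DecSetoid _ _
  ~-decSetoid = record
    { Carrier = ℕ ; _≈_ = _~_
    ; isDecEquivalence = record
      { isEquivalence = record
        { refl  = λ {s} → ~-intro s 0 (cong (_% n) (ℕₚ.*-identityʳ s))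
        ; sym   = ~-sym
        ; trans = λ {s} → ~-trans {s} }
      ; _≟_ = _~?_ } }

  -- `units` repeats the list counted in `φ`, so that its length is `φ n` by definition.
  units reps : List ℕ
  units = filter (λ k → gcd k n ≟ 1) (map suc (upTo n))
  reps  = deduplicate _~?_ units

  units-unique : Unique units
  units-unique = Unique.filter⁺ _ (Unique.map⁺ ℕₚ.suc-injective (Unique.upTo⁺ n))

  ∈-units⁺ : ∀ {a} → 0 < a → a ≤ n → Coprime a n → a ∈ units
  ∈-units⁺ {suc a} _ a<n cop = ∈-filter⁺ (λ k → gcd k n ≟ 1) (∈-map⁺ suc (∈-upTo⁺ a<n)) (coprime⇒gcd≡1 cop)

  ∈-units⁻ : ∀ {a} → a ∈ units → 0 < a × a ≤ n × Coprime a n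
  ∈-units⁻ a∈ with ∈-filter⁻ (λ k → gcd k n ≟ 1) {xs = map suc (upTo n)} a∈
  ... | a∈′ , g with ∈-map⁻ suc a∈′
  ... | _ , i∈ , refl = s≤s z≤n , ∈-upTo⁻ i∈ , gcd≡1⇒coprime g

  reps⊆units : ∀ {r} → r ∈ reps → r ∈ units
  reps⊆units = ∈-deduplicate⁻ _~?_ units

  reps-AllPairs : AllPairs (λ r s → ¬ (r ~ s)) reps
  reps-AllPairs = DecUnique.deduplicate-! ~-decSetoid units

  reps-≡ : ∀ {r s} → r ∈ reps → s ∈ reps → r ~ s → r ≡ s
  reps-≡ = ∈-AllPairs⇒≡ (λ {r} {s} → ~-sym {r} {s}) reps-AllPairs

  reps-unique : Unique reps
  reps-unique = AllPairs.map (λ {r} r≁s r≡s → r≁s (subst (r ~_) r≡s (DecSetoid.refl ~-decSetoid))) reps-AllPairs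

  -- Deduplication keeps a member related to each entry of `units`, and `red a` is the entry
  -- congruent to `a`.
  reps-complete : ∀ {a} → Coprime a n → ∃ λ r → r ∈ reps × r ~ a
  reps-complete {a} cop = find any
    where
    red∈ : red a ∈ units
    red∈ = ∈-units⁺ (0<red a) (red≤n a) (coprime-resp (sym (red-≡ₙ a)) cop)
    any : Any (_~ a) reps
    any = Anyₚ.deduplicate⁺ _~?_ (λ {x} {y} y~x x~a → ~-trans {y} {x} y~x x~a)
            (lose red∈ (~-intro (red a) 0 (trans (cong (_% n) (ℕₚ.*-identityʳ _)) (red-≡ₙ a))))

  translates : List ℕ
  translates = map (λ (r , k) → red (r * p ^ k)) (cartesianProduct reps (upTo m))

  -- A coincidence relates the two representatives, so they are equal; cancelling this unit leaves
  -- congruent powers of `p` with exponents below `m`.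
  translates-unique : Unique translates
  translates-unique = AllPairs-map⁺ distinct (Unique.cartesianProduct⁺ reps-unique (Unique.upTo⁺ m))
    where
    distinct : ∀ {x y} → x ∈ cartesianProduct reps (upTo m) → y ∈ cartesianProduct reps (upTo m) → x ≢ y →
               red (proj₁ x * p ^ proj₂ x) ≢ red (proj₁ y * p ^ proj₂ y)
    distinct {r , i} {s , j} x∈ y∈ x≢y eq
      with ∈-cartesianProduct⁻ reps (upTo m) x∈ | ∈-cartesianProduct⁻ reps (upTo m) y∈
    ... | r∈ , i∈ | s∈ , j∈ with reps-≡ r∈ s∈ (~-trans {r} {r * p ^ i} (i , ∈-upTo⁻ i∈ , refl)
                                   (~-sym {s} (j , ∈-upTo⁻ j∈ , sym e)))
      where
      e : r * p ^ i ≡ₙ s * p ^ j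
      e = trans (sym (red-≡ₙ _)) (trans (cong (_% n) eq) (red-≡ₙ _))
    ... | refl = x≢y (cong (r ,_) (p^-injectiveₙ (∈-upTo⁻ i∈) (∈-upTo⁻ j∈)
                   (cancelₙ {r} (proj₂ (proj₂ (∈-units⁻ (reps⊆units r∈))))
                     (trans (sym (red-≡ₙ _)) (trans (cong (_% n) eq) (red-≡ₙ _))))))

  translates-↭ : translates ↭ units
  translates-↭ = unique-↭ translates-unique units-unique into onto
    where
    into : ∀ {a} → a ∈ translates → a ∈ units
    into a∈ with ∈-map⁻ _ a∈
    ... | (r , k) , rk∈ , refl =
      let r∈ , _ = ∈-cartesianProduct⁻ reps (upTo m) rk∈
          _ , _ , cop = ∈-units⁻ (reps⊆units r∈)
      in ∈-units⁺ (0<red _) (red≤n _) (coprime-resp (sym (red-≡ₙ (r * p ^ k))) (coprime-* cop (coprime-p^ k)))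
    onto : ∀ {a} → a ∈ units → a ∈ translates
    onto {a} a∈ =
      let 0<a , a≤n , cop = ∈-units⁻ a∈
          r , r∈ , k , k<m , e = reps-complete cop
      in subst (_∈ translates) (trans (red-cong e) (red-id 0<a a≤n))
           (∈-map⁺ _ (∈-cartesianProduct⁺ r∈ (∈-upTo⁺ k<m)))

  -- The translates arrange the units as pairs of a representative and an exponent below `m`, so the
  -- division is exact.
  length-reps : length reps ≡ φ n / m
  length-reps = begin
    length reps                                ≡⟨ m*n/n≡m (length reps) m ⟨
    length reps * m / m                        ≡⟨ cong (_/ m) len ⟩
    φ n / m                                    ∎
    where
    open ≡-Reasoning
    len : length reps * m ≡ φ n
    len = begin
      length reps * m                            ≡⟨ cong (length reps *_) (List.length-upTo m) ⟨
      length reps * length (upTo m)              ≡⟨ length-cartesianProductWith _,_ reps (upTo m) ⟨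
      length (cartesianProduct reps (upTo m))    ≡⟨ List.length-map _ (cartesianProduct reps (upTo m)) ⟨
      length translates                          ≡⟨ ↭-length translates-↭ ⟩
      length units                               ∎

-- Positive products, binomial coefficients modulo a prime, and translated folds.

prod>0 : ∀ n f → (∀ {i} → i < n → 0 < f i) → 0 < prod n f
prod>0 zero    f h = s≤s z≤n
prod>0 (suc n) f h = ℕₚ.*-mono-≤ (prod>0 n f (λ i<n → h (ℕₚ.m<n⇒m<1+n i<n))) (h ℕₚ.≤-refl)

-- Pascal's rule splits the left side, and the two induction hypotheses, joined by Pascal's rule
-- again, give the right side. Neither factorials nor division occur.
absorption : ∀ n k → suc k ℕ.* (suc n C suc k) ≡ suc n ℕ.* (n C k)
absorption n zero = begin
  1 ℕ.* (suc n C 1)    ≡⟨ ℕₚ.*-identityˡ _ ⟩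
  suc n C 1            ≡⟨ nC1≡n (suc n) ⟩
  suc n                ≡⟨ ℕₚ.*-identityʳ (suc n) ⟨
  suc n ℕ.* (n C 0)    ∎
  where open ≡-Reasoning
absorption zero (suc k) = ℕₚ.*-zeroʳ (suc (suc k))
absorption (suc n) (suc k) = begin
  suc k′ ℕ.* (suc n′ C suc k′)                               ≡⟨ cong (suc k′ ℕ.*_) (nCk+nC[k+1]≡[n+1]C[k+1] n′ k′) ⟨
  suc k′ ℕ.* (n′ C k′ ℕ.+ n′ C suc k′)                       ≡⟨ ℕₚ.*-distribˡ-+ (suc k′) (n′ C k′) _ ⟩
  n′ C k′ ℕ.+ k′ ℕ.* (n′ C k′) ℕ.+ suc k′ ℕ.* (n′ C suc k′)  ≡⟨ cong₂ (λ a b → n′ C k′ ℕ.+ a ℕ.+ b) (absorption n k) (absorption n k′) ⟩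
  n′ C k′ ℕ.+ n′ ℕ.* (n C k) ℕ.+ n′ ℕ.* (n C k′)             ≡⟨ ℕₚ.+-assoc (n′ C k′) _ _ ⟩
  n′ C k′ ℕ.+ (n′ ℕ.* (n C k) ℕ.+ n′ ℕ.* (n C k′))           ≡⟨ cong (n′ C k′ ℕ.+_) (ℕₚ.*-distribˡ-+ n′ (n C k) _) ⟨
  n′ C k′ ℕ.+ n′ ℕ.* (n C k ℕ.+ n C k′)                      ≡⟨ cong (λ c → n′ C k′ ℕ.+ n′ ℕ.* c) (nCk+nC[k+1]≡[n+1]C[k+1] n k) ⟩
  n′ C k′ ℕ.+ n′ ℕ.* (n′ C k′)                               ∎
  where
  open ≡-Reasoning
  n′ = suc n
  k′ = suc k

-- By absorption `p` divides `k * (p C k)`, and it cannot divide `k`, which is positive and smaller.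
prime∣C : ∀ {p k} → Prime p → 0 < k → k < p → p ∣ p C k
prime∣C {suc n} {suc k} pr _ k<p with euclidsLemma (suc k) (suc n C suc k) pr
                                       (subst (suc n ∣_) (sym (absorption n k)) (m∣m*n (n C k)))
... | inj₁ p∣k = ⊥-elim (ℕₚ.<⇒≱ k<p (∣⇒≤ p∣k))
... | inj₂ p∣C = p∣C

-- If translation by a permutes a finite family, comparing the folds over the
-- family before and after translation gives information on length xs · a:
-- this yields both the characteristic and Fermat's little theorem.
module _ (M : CommutativeMonoid 0ℓ 0ℓ) where

  open CommutativeMonoid M renaming (refl to ≈-refl; sym to ≈-sym; trans to ≈-trans)
  open Mult M using () renaming (_×_ to _·_)
  open CommutativeSemigroup commutativeSemigroup using (interchange)

  fold-translate : ∀ {a xs} → map (a ∙_) xs ↭ xs → (length xs · a) ∙ foldr _∙_ ε xs ≈ foldr _∙_ ε xs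
  fold-translate {a} {xs} π = ≈-trans (≈-sym (shift xs)) (foldr-commMonoid setoid isCommutativeMonoid (↭⇒↭ₛ′ isEquivalence π))
    where
    shift : ∀ xs → foldr _∙_ ε (map (a ∙_) xs) ≈ (length xs · a) ∙ foldr _∙_ ε xs
    shift []       = ≈-sym (identityˡ ε)
    shift (x ∷ xs) = ≈-trans (∙-congˡ (shift xs)) (interchange a x _ _)

-- Finite fields: cancellation, powers and Fermat's theorem.

module FieldTheory {q} (F : FiniteField q) where

  open FiniteField F

  commutativeRing : CommutativeRing 0ℓ 0ℓ
  commutativeRing = record { isCommutativeRing = isCommutativeRing }

  open CommutativeRing commutativeRing public
    using (+-assoc; +-comm; +-identityˡ; +-identityʳ; *-assoc; *-comm; *-identityˡ; *-identityʳ;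
           distribˡ; distribʳ; zeroˡ; zeroʳ; -‿inverseʳ;
           semiring; commutativeSemiring; ring; +-commutativeMonoid; *-commutativeMonoid;
           +-commutativeSemigroup)
  open RingProperties ring public using (+-cancelˡ; +-cancelʳ; -‿distribˡ-*; +-inverseʳ-unique)
  open Mult +-commutativeMonoid public using () renaming (_×_ to _·_; ×-homo-+ to ·-homo-+; ×-assocˡ to ·-assocˡ; ×-distrib-+ to ·-distrib-+)
  open CommutativeSemigroup +-commutativeSemigroup public using () renaming (interchange to +-interchange)

  infix 4 _≟_
  _≟_ : DecidableEquality Carrier
  _≟_ = Finₚ.inj⇒≟ (Inverse⇒Injection (↔-sym enumeration))

  elems : List Carrier
  elems = map (Inverse.to enumeration) (allFin q)

  elems-enumerates : Enumerates elems
  elems-enumerates =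
    Unique.map⁺ (Injection.injective (Inverse⇒Injection enumeration)) (Unique.allFin⁺ q) ,
    λ x → subst (_∈ elems) (Inverse.strictlyInverseˡ enumeration x) (∈-map⁺ _ (∈-allFin _))

  length-elems : length elems ≡ q
  length-elems = trans (List.length-map _ (allFin q)) (List.length-tabulate {n = q} (λ i → i))

  *-cancelˡ : ∀ {x y z} → x ≢ 0# → x * y ≡ x * z → y ≡ z
  *-cancelˡ {x} {y} {z} x≢0 e = begin
    y              ≡⟨ unit y ⟨
    x⁻¹ * (x * y)  ≡⟨ cong (x⁻¹ *_) e ⟩
    x⁻¹ * (x * z)  ≡⟨ unit z ⟩
    z              ∎
    where
    open ≡-Reasoning
    x⁻¹ = proj₁ (inverse x x≢0)
    unit : ∀ w → x⁻¹ * (x * w) ≡ w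
    unit w = trans (sym (*-assoc x⁻¹ x w))
      (trans (cong (_* w) (trans (*-comm x⁻¹ x) (proj₂ (inverse x x≢0)))) (*-identityˡ w))

  *-nonzero : ∀ {x y} → x ≢ 0# → y ≢ 0# → x * y ≢ 0#
  *-nonzero x≢0 y≢0 e = y≢0 (*-cancelˡ x≢0 (trans e (sym (zeroʳ _))))

  ^≡ : ∀ x n → x ^ n ≡ Exp._^_ semiring x n
  ^≡ x zero    = refl
  ^≡ x (suc n) = cong (x *_) (^≡ x n)

  1^ : ∀ n → 1# ^ n ≡ 1#
  1^ zero    = refl
  1^ (suc n) = trans (*-identityˡ _) (1^ n)

  0^ : ∀ {n} → 0 < n → 0# ^ n ≡ 0#
  0^ {suc n} _ = zeroˡ _

  ^-nonzero : ∀ {x} n → x ≢ 0# → x ^ n ≢ 0#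
  ^-nonzero zero    x≢0 = 0≢1 ∘ sym
  ^-nonzero (suc n) x≢0 = *-nonzero x≢0 (^-nonzero n x≢0)

  ^-homo-* : ∀ x m n → x ^ (m ℕ.+ n) ≡ x ^ m * x ^ n
  ^-homo-* x m n = trans (^≡ x (m ℕ.+ n)) (trans (Exp.^-homo-* semiring x m n) (cong₂ _*_ (sym (^≡ x m)) (sym (^≡ x n))))

  ^-assocʳ : ∀ x m n → (x ^ m) ^ n ≡ x ^ (m ℕ.* n)
  ^-assocʳ x m n = trans (^≡ (x ^ m) n) (trans (cong (λ y → Exp._^_ semiring y n) (^≡ x m))
    (trans (Exp.^-assocʳ semiring x m n) (sym (^≡ x (m ℕ.* n)))))

  ^-distrib-* : ∀ x y n → (x * y) ^ n ≡ x ^ n * y ^ n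
  ^-distrib-* x y n = trans (^≡ (x * y) n) (trans (CommExp.^-distrib-* commutativeSemiring x y n)
    (cong₂ _*_ (sym (^≡ x n)) (sym (^≡ y n))))

  nonzeros : List Carrier
  nonzeros = filter (λ x → ¬? (x ∈? (0# ∷ []))) elems
    where open import Data.List.Membership.DecPropositional _≟_ using (_∈?_)

  nonzeros-unique : Unique nonzeros
  nonzeros-unique = Unique.filter⁺ _ (proj₁ elems-enumerates)

  length-nonzeros : length nonzeros ≡ q ℕ.∸ 1
  length-nonzeros = trans (length-filter-∉ _≟_ elems-enumerates ([] ∷ [])) (cong (ℕ._∸ 1) length-elems)

  ∈-nonzeros⁺ : ∀ {x} → x ≢ 0# → x ∈ nonzeros
  ∈-nonzeros⁺ x≢0 = ∈-filter⁺ _ (proj₂ elems-enumerates _) λ { (here x≡0) → x≢0 x≡0 }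

  ∈-nonzeros⁻ : ∀ {x} → x ∈ nonzeros → x ≢ 0#
  ∈-nonzeros⁻ x∈ x≡0 = proj₂ (∈-filter⁻ _ {xs = elems} x∈) (here x≡0)

  -- Translation by 1 permutes the field, so adding `q · 1#` leaves the sum of all elements
  -- unchanged.
  q·1≡0 : q · 1# ≡ 0#
  q·1≡0 = subst (λ n → n · 1# ≡ 0#) length-elems
    (+-cancelʳ _ _ _ (trans (fold-translate +-commutativeMonoid π) (sym (+-identityˡ _))))
    where
    π : map (1# +_) elems ↭ elems
    π = unique-↭ (Unique.map⁺ (+-cancelˡ 1# _ _) (proj₁ elems-enumerates)) (proj₁ elems-enumerates)
      (λ _ → proj₂ elems-enumerates _)
      (λ {x} _ → subst (_∈ map (1# +_) elems) (trans (sym (+-assoc _ _ _)) (trans (cong (_+ x) (-‿inverseʳ 1#)) (+-identityˡ x)))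
                   (∈-map⁺ (1# +_) (proj₂ elems-enumerates (- 1# + x))))

  -- Multiplication by `x` permutes the nonzero elements, and their product `Π` is nonzero, so it
  -- can be cancelled.
  fermat : ∀ {x} → x ≢ 0# → x ^ (q ℕ.∸ 1) ≡ 1#
  fermat {x} x≢0 = trans (cong (x ^_) (sym length-nonzeros)) (*-cancelˡ (product≢0 nonzeros ∈-nonzeros⁻) (begin
    Π * x ^ length nonzeros   ≡⟨ *-comm _ _ ⟩
    x ^ length nonzeros * Π   ≡⟨ cong (_* Π) (^≡ x (length nonzeros)) ⟩
    _                         ≡⟨ fold-translate *-commutativeMonoid π ⟩
    Π                         ≡⟨ *-identityʳ Π ⟨
    Π * 1#                    ∎))
    where
    open ≡-Reasoning
    Π = foldr _*_ 1# nonzeros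
    product≢0 : ∀ ys → (∀ {y} → y ∈ ys → y ≢ 0#) → foldr _*_ 1# ys ≢ 0#
    product≢0 []       h = 0≢1 ∘ sym
    product≢0 (y ∷ ys) h = *-nonzero (h (here refl)) (product≢0 ys (h ∘ there))
    into : ∀ {y} → y ∈ map (x *_) nonzeros → y ∈ nonzeros
    into y∈ with ∈-map⁻ (x *_) y∈
    ... | z , z∈ , refl = ∈-nonzeros⁺ (*-nonzero x≢0 (∈-nonzeros⁻ z∈))
    onto : ∀ {y} → y ∈ nonzeros → y ∈ map (x *_) nonzeros
    onto {y} y∈ = subst (_∈ map (x *_) nonzeros) eq (∈-map⁺ (x *_) (∈-nonzeros⁺ z≢0))
      where
      x⁻¹ = proj₁ (inverse x x≢0)
      eq : x * (x⁻¹ * y) ≡ y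
      eq = trans (sym (*-assoc x x⁻¹ y)) (trans (cong (_* y) (proj₂ (inverse x x≢0))) (*-identityˡ y))
      z≢0 : x⁻¹ * y ≢ 0#
      z≢0 e = ∈-nonzeros⁻ y∈ (trans (sym eq) (trans (cong (x *_) e) (zeroʳ x)))
    π : map (x *_) nonzeros ↭ nonzeros
    π = unique-↭ (Unique.map⁺ (*-cancelˡ x≢0) nonzeros-unique) nonzeros-unique into onto

  surjective⇒permutation : ∀ {f} → (∀ y → ∃ λ x → f x ≡ y) → IsPermutation f
  surjective⇒permutation sur = (λ _ _ → surjective⇒injective _≟_ elems-enumerates sur) , sur

  injective⇒permutation : ∀ {f} → (∀ {x y} → f x ≡ f y → x ≡ y) → IsPermutation f
  injective⇒permutation inj = (λ _ _ → inj) , injective⇒surjective _≟_ elems-enumerates inj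

  -- Finite sums in the field.

  sumF-cong : ∀ n {f g} → (∀ {i} → i < n → f i ≡ g i) → sumF n f ≡ sumF n g
  sumF-cong zero    h = refl
  sumF-cong (suc n) h = cong₂ _+_ (sumF-cong n (λ i<n → h (ℕₚ.m<n⇒m<1+n i<n))) (h ℕₚ.≤-refl)

  sumF-0 : ∀ n → sumF n (λ _ → 0#) ≡ 0#
  sumF-0 zero    = refl
  sumF-0 (suc n) = trans (+-identityʳ _) (sumF-0 n)

  sumF-+ : ∀ n f g → sumF n (λ i → f i + g i) ≡ sumF n f + sumF n g
  sumF-+ zero    f g = sym (+-identityˡ 0#)
  sumF-+ (suc n) f g = trans (cong (_+ (f n + g n)) (sumF-+ n f g)) (+-interchange (sumF n f) (sumF n g) (f n) (g n))

  sumF-* : ∀ n x f → sumF n (λ i → x * f i) ≡ x * sumF n f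
  sumF-* zero    x f = sym (zeroʳ x)
  sumF-* (suc n) x f = trans (cong (_+ x * f n) (sumF-* n x f)) (sym (distribˡ x _ _))

  sumF-head : ∀ n f → sumF (suc n) f ≡ f 0 + sumF n (f ∘ suc)
  sumF-head zero    f = +-comm 0# (f 0)
  sumF-head (suc n) f = trans (cong (_+ f (suc n)) (sumF-head n f)) (+-assoc (f 0) _ _)

  sumF-swap : ∀ m n (f : ℕ → ℕ → Carrier) →
              sumF m (λ i → sumF n (f i)) ≡ sumF n (λ j → sumF m (λ i → f i j))
  sumF-swap zero    n f = sym (sumF-0 n)
  sumF-swap (suc m) n f = trans (cong (_+ sumF n (f m)) (sumF-swap m n f)) (sym (sumF-+ n _ _))

  δ : ℕ → ℕ → Carrier
  δ i j with i ℕ.≟ j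
  ... | yes _ = 1#
  ... | no  _ = 0#

  δ-≡ : ∀ i → δ i i ≡ 1#
  δ-≡ i with i ℕ.≟ i
  ... | yes _  = refl
  ... | no i≢i = ⊥-elim (i≢i refl)

  δ-≢ : ∀ {i j} → i ≢ j → δ i j ≡ 0#
  δ-≢ {i} {j} i≢j with i ℕ.≟ j
  ... | yes i≡j = ⊥-elim (i≢j i≡j)
  ... | no  _   = refl

  sumF-δ : ∀ {n i} → i < n → (f : ℕ → Carrier) → sumF n (λ j → δ i j * f j) ≡ f i
  sumF-δ {suc n} {i} i<1+n f with ℕₚ.m<1+n⇒m<n∨m≡n i<1+n
  ... | inj₁ i<n  = trans (cong₂ _+_ (sumF-δ i<n f) (trans (cong (_* f n) (δ-≢ (ℕₚ.<⇒≢ i<n))) (zeroˡ (f n)))) (+-identityʳ (f i))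
  ... | inj₂ refl = begin
    sumF n (λ j → δ n j * f j) + δ n n * f n
      ≡⟨ cong₂ _+_ (sumF-cong n (λ {j} j<n → trans (cong (_* f j) (δ-≢ (ℕₚ.<⇒≢ j<n ∘ sym))) (zeroˡ (f j))))
                   (trans (cong (_* f n) (δ-≡ n)) (*-identityˡ (f n))) ⟩
    sumF n (λ _ → 0#) + f n    ≡⟨ cong (_+ f n) (sumF-0 n) ⟩
    0# + f n                   ≡⟨ +-identityˡ (f n) ⟩
    f n                        ∎
    where open ≡-Reasoning

  -- Polynomials of degree below `q` are determined by their values.

  eval : ∀ {n} → Vec Carrier n → Carrier → Carrier
  eval []       x = 0#
  eval (a ∷ as) x = a + x * eval as x

  -- Synthetic division by x - r.
  quotient : ∀ {n} → Carrier → Vec Carrier (suc n) → Vec Carrier n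
  quotient {zero}  r (a ∷ [])  = []
  quotient {suc n} r (a ∷ bs)  = eval bs r ∷ quotient r bs

  -- f(x) - f(r) = (x - r) g(x), with both sides moved so that no subtraction occurs.
  eval-quotient : ∀ {n} (as : Vec Carrier (suc n)) r x →
                  eval as x + r * eval (quotient r as) x ≡ eval as r + x * eval (quotient r as) x
  eval-quotient {zero}  (a ∷ []) r x =
    solve 3 (λ a r x → (a :+ x :* con 0) :+ r :* con 0 := (a :+ r :* con 0) :+ x :* con 0) refl a r x
    where open RingSolver commutativeSemiring
  eval-quotient {suc n} (a ∷ bs) r x = begin
    (a + x * B x) + r * (B r + x * h)   ≡⟨ solve 6 (λ a x r Bx Br h → (a :+ x :* Bx) :+ r :* (Br :+ x :* h) := (a :+ r :* Br) :+ x :* (Bx :+ r :* h)) refl a x r (B x) (B r) h ⟩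
    (a + r * B r) + x * (B x + r * h)   ≡⟨ cong (λ y → (a + r * B r) + x * y) (eval-quotient bs r x) ⟩
    (a + r * B r) + x * (B r + x * h)   ∎
    where
    open ≡-Reasoning
    open RingSolver commutativeSemiring
    B = eval bs
    h = eval (quotient r bs) x

  -- The entries of the quotient are the values at `r` of the successive tails. When these vanish,
  -- each coefficient equals the value of the tail it starts, which is zero.
  quotient-zero : ∀ {n} (as : Vec Carrier (suc n)) r → eval as r ≡ 0# →
                  VAll.All (_≡ 0#) (quotient r as) → VAll.All (_≡ 0#) as
  quotient-zero {zero}  (a ∷ []) r e _ = trans (sym (trans (cong (a +_) (zeroʳ r)) (+-identityʳ a))) e ∷ []
  quotient-zero {suc n} (a ∷ bs) r e (b≡0 ∷ h) =
    trans (sym (trans (cong (λ b → a + r * b) b≡0) (trans (cong (a +_) (zeroʳ r)) (+-identityʳ a)))) e ∷ quotient-zero bs r b≡0 h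

  -- Induction on the number of coefficients: dividing by `x - r` removes one coefficient and one
  -- root, and the other roots survive.
  roots⇒zero : ∀ {n} (as : Vec Carrier n) (xs : List Carrier) → Unique xs → length xs ≡ n →
               (∀ {x} → x ∈ xs → eval as x ≡ 0#) → VAll.All (_≡ 0#) as
  roots⇒zero [] xs u l h = []
  roots⇒zero as@(_ ∷ _) (r ∷ xs) (r∉ ∷ u) l h =
    quotient-zero as r (h (here refl)) (roots⇒zero (quotient r as) xs u (ℕₚ.suc-injective l) root)
    where
    root : ∀ {x} → x ∈ xs → eval (quotient r as) x ≡ 0#
    root {x} x∈ with eval (quotient r as) x ≟ 0#
    ... | yes e = e
    -- Both values of the polynomial are zero, so `eval-quotient` leaves `r * g = x * g` for the
    -- value `g` of the quotient; a nonzero `g` would force `r ≡ x`.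
    ... | no ≢0 = ⊥-elim (All.lookup r∉ x∈ (*-cancelˡ ≢0
      (trans (*-comm _ r) (trans (+-cancelˡ (eval as r) _ _
        (trans (cong (_+ r * eval (quotient r as) x) (trans (h (here refl)) (sym (h (there x∈))))) (eval-quotient as r x))) (*-comm x _)))))

  coeffs : ∀ n → (ℕ → Carrier) → Vec Carrier n
  coeffs zero    A = []
  coeffs (suc n) A = A 0 ∷ coeffs n (A ∘ suc)

  eval-coeffs : ∀ n A x → eval (coeffs n A) x ≡ sumF n (λ i → A i * x ^ i)
  eval-coeffs zero    A x = refl
  eval-coeffs (suc n) A x = begin
    A 0 + x * eval (coeffs n (A ∘ suc)) x                ≡⟨ cong₂ (λ a b → a + x * b) (sym (*-identityʳ (A 0))) (eval-coeffs n (A ∘ suc) x) ⟩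
    A 0 * 1# + x * sumF n (λ i → A (suc i) * x ^ i)      ≡⟨ cong (A 0 * 1# +_) (sumF-* n x _) ⟨
    A 0 * 1# + sumF n (λ i → x * (A (suc i) * x ^ i))    ≡⟨ cong (A 0 * 1# +_) (sumF-cong n (λ {i} _ → x∙yz≈y∙xz x (A (suc i)) (x ^ i))) ⟩
    A 0 * 1# + sumF n (λ i → A (suc i) * x ^ suc i)      ≡⟨ sumF-head n (λ i → A i * x ^ i) ⟨
    sumF (suc n) (λ i → A i * x ^ i)                     ∎
    where
    open ≡-Reasoning
    open CommutativeSemigroup (CommutativeMonoid.commutativeSemigroup *-commutativeMonoid) using (x∙yz≈y∙xz)

  -- There are `q` coefficients and all `q` field elements are roots.
  coefficients-zero : (A : ℕ → Carrier) → (∀ x → sumF q (λ i → A i * x ^ i) ≡ 0#) → ∀ {i} → i < q → A i ≡ 0#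
  coefficients-zero A h = lookup q A
    (roots⇒zero (coeffs q A) elems (proj₁ elems-enumerates) length-elems (λ {x} _ → trans (eval-coeffs q A x) (h x)))
    where
    lookup : ∀ n A → VAll.All (_≡ 0#) (coeffs n A) → ∀ {i} → i < n → A i ≡ 0#
    lookup (suc n) A (e ∷ es) {zero}  _         = e
    lookup (suc n) A (e ∷ es) {suc i} (s≤s i<n) = lookup n (A ∘ suc) es i<n

  coefficients-unique : (A B : ℕ → Carrier) → (∀ x → sumF q (λ i → A i * x ^ i) ≡ sumF q (λ i → B i * x ^ i)) →
                        ∀ {i} → i < q → A i ≡ B i
  coefficients-unique A B h {i} i<q = +-cancelʳ (- B i) (A i) (B i)
    (trans (coefficients-zero (λ i → A i + - B i) vanish i<q) (sym (-‿inverseʳ (B i))))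
    where
    open ≡-Reasoning
    vanish : ∀ x → sumF q (λ i → (A i + - B i) * x ^ i) ≡ 0#
    vanish x = begin
      sumF q (λ i → (A i + - B i) * x ^ i)                             ≡⟨ sumF-cong q (λ {i} _ → distribʳ (x ^ i) (A i) (- B i)) ⟩
      sumF q (λ i → A i * x ^ i + - B i * x ^ i)                       ≡⟨ sumF-+ q _ _ ⟩
      sumF q (λ i → A i * x ^ i) + sumF q (λ i → - B i * x ^ i)        ≡⟨ cong (_+ sumF q (λ i → - B i * x ^ i)) (h x) ⟩
      sumF q (λ i → B i * x ^ i) + sumF q (λ i → - B i * x ^ i)        ≡⟨ sumF-+ q _ _ ⟨
      sumF q (λ i → B i * x ^ i + - B i * x ^ i)                       ≡⟨ sumF-cong q (λ {i} _ → sym (distribʳ (x ^ i) (B i) (- B i))) ⟩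
      sumF q (λ i → (B i + - B i) * x ^ i)                             ≡⟨ sumF-cong q (λ {i} _ → trans (cong (_* x ^ i) (-‿inverseʳ (B i))) (zeroˡ (x ^ i))) ⟩
      sumF q (λ _ → 0#)                                                ≡⟨ sumF-0 q ⟩
      0#                                                               ∎

  -- The coefficients of the sparse polynomial Σ_{j<k} b j x^(e j).
  spread : ℕ → (ℕ → ℕ) → (ℕ → Carrier) → ℕ → Carrier
  spread k e b i = sumF k (λ j → δ (e j) i * b j)

  sumF-spread : ∀ k e b → (∀ {j} → j < k → e j < q) → ∀ x →
                sumF q (λ i → spread k e b i * x ^ i) ≡ sumF k (λ j → b j * x ^ e j)
  sumF-spread k e b e<q x = begin
    sumF q (λ i → spread k e b i * x ^ i)                        ≡⟨ sumF-cong q (λ {i} _ → pull i) ⟩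
    sumF q (λ i → sumF k (λ j → δ (e j) i * (b j * x ^ i)))      ≡⟨ sumF-swap q k _ ⟩
    sumF k (λ j → sumF q (λ i → δ (e j) i * (b j * x ^ i)))      ≡⟨ sumF-cong k (λ {j} j<k → sumF-δ (e<q j<k) (λ i → b j * x ^ i)) ⟩
    sumF k (λ j → b j * x ^ e j)                                 ∎
    where
    open ≡-Reasoning
    pull : ∀ i → spread k e b i * x ^ i ≡ sumF k (λ j → δ (e j) i * (b j * x ^ i))
    pull i = begin
      spread k e b i * x ^ i                        ≡⟨ *-comm _ _ ⟩
      x ^ i * spread k e b i                        ≡⟨ sumF-* k (x ^ i) _ ⟨
      sumF k (λ j → x ^ i * (δ (e j) i * b j))      ≡⟨ sumF-cong k (λ {j} _ → trans (*-comm _ _) (*-assoc (δ (e j) i) (b j) (x ^ i))) ⟩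
      sumF k (λ j → δ (e j) i * (b j * x ^ i))      ∎

  -- No two terms land on the same exponent, so the sum collapses to the term with index `j`.
  spread-injective : ∀ k e b → (∀ {i j} → i < k → j < k → e i ≡ e j → i ≡ j) →
                     ∀ {j} → j < k → spread k e b (e j) ≡ b j
  spread-injective k e b inj {j} j<k = trans (sumF-cong k swap) (sumF-δ j<k b)
    where
    swap : ∀ {i} → i < k → δ (e i) (e j) * b i ≡ δ j i * b i
    swap {i} i<k with i ℕ.≟ j
    ... | yes refl = cong (_* b i) (trans (δ-≡ (e i)) (sym (δ-≡ i)))
    ... | no  i≢j  = cong (_* b i) (trans (δ-≢ (i≢j ∘ inj i<k j<k)) (sym (δ-≢ (i≢j ∘ sym))))

  -- Otherwise the coefficient of `x ^ r` would be 0 on the sparse side and 1 on the other.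
  monomial≡sparse : ∀ r k e b → r < q → (∀ {j} → j < k → e j < q) →
                    (∀ x → x ^ r ≡ sumF k (λ j → b j * x ^ e j)) → ∃ λ j → j < k × e j ≡ r
  monomial≡sparse r k e b r<q e<q h with ℕₚ.anyUpTo? (λ j → e j ℕ.≟ r) k
  ... | yes found = found
  ... | no  none  = ⊥-elim (0≢1 (begin
    0#                               ≡⟨ sumF-0 k ⟨
    sumF k (λ _ → 0#)                ≡⟨ sumF-cong k (λ {j} j<k → trans (sym (zeroˡ (b j))) (cong (_* b j) (sym (δ-≢ (λ e≡r → none (j , j<k , e≡r)))))) ⟩
    spread k e b r                   ≡⟨ coefficients-unique (spread k e b) (δ r) same r<q ⟩
    δ r r                            ≡⟨ δ-≡ r ⟩
    1#                               ∎))
    where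
    open ≡-Reasoning
    same : ∀ x → sumF q (λ i → spread k e b i * x ^ i) ≡ sumF q (λ i → δ r i * x ^ i)
    same x = trans (sumF-spread k e b e<q x) (trans (sym (h x)) (sym (sumF-δ r<q (x ^_))))

  -- Additive maps.

  Additive : (Carrier → Carrier) → Set
  Additive f = ∀ x y → f (x + y) ≡ f x + f y

  additive-0 : ∀ {f} → Additive f → f 0# ≡ 0#
  additive-0 {f} add = +-cancelˡ (f 0#) _ _
    (trans (sym (add 0# 0#)) (trans (cong f (+-identityˡ 0#)) (sym (+-identityʳ (f 0#)))))

  additive-· : ∀ {f} → Additive f → ∀ k x → f (k · x) ≡ k · f x
  additive-· add zero    x = additive-0 add
  additive-· {f} add (suc k) x = trans (add x (k · x)) (cong (f x +_) (additive-· add k x))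

  additive-- : ∀ {f} → Additive f → ∀ x y → f (x - y) ≡ f x - f y
  additive-- {f} add x y = trans (add x (- y)) (cong (f x +_)
    (+-inverseʳ-unique (f y) (f (- y)) (trans (sym (add y (- y))) (trans (cong f (-‿inverseʳ y)) (additive-0 add)))))

-- Characteristic `p` and the Frobenius map.

module Costas (p m : ℕ) (pr : Prime p) .{{_ : NonZero m}} (F : FiniteField (p ℕ.^ m)) where

  open FiniteField F
  open FieldTheory F

  -- The element `q · 1#` is the product of `m` copies of `p · 1#`, and a field has no zero
  -- divisors.
  p·1≡0 : p · 1# ≡ 0#
  p·1≡0 with p · 1# ≟ 0#
  ... | yes e = e
  ... | no ≢0 = ⊥-elim (power≢0 m q·1≡0)
    where
    power≢0 : ∀ k → (p ℕ.^ k) · 1# ≢ 0#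
    power≢0 zero    e = 0≢1 (trans (sym e) (+-identityʳ 1#))
    power≢0 (suc k) e = *-nonzero ≢0 (power≢0 k) (trans (sym (SemiringMult.×1-homo-* semiring p (p ℕ.^ k))) e)

  p∣⇒·≡0 : ∀ {k} → p ∣ k → ∀ x → k · x ≡ 0#
  p∣⇒·≡0 (divides j refl) x = begin
    (j ℕ.* p) · x          ≡⟨ cong (_· x) (ℕₚ.*-comm j p) ⟩
    (p ℕ.* j) · x          ≡⟨ ·-assocˡ x p j ⟨
    p · (j · x)            ≡⟨ cong (p ·_) (*-identityˡ (j · x)) ⟨
    p · (1# * (j · x))     ≡⟨ SemiringMult.×-assoc-* semiring p 1# (j · x) ⟨
    (p · 1#) * (j · x)     ≡⟨ cong (_* (j · x)) p·1≡0 ⟩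
    0# * (j · x)           ≡⟨ zeroˡ _ ⟩
    0#                     ∎
    where open ≡-Reasoning

  -- In the binomial expansion all interior coefficients are divisible by `p`, so only the two end
  -- terms survive.
  frobenius-additive : Additive (_^ p)
  frobenius-additive x y = aux p pr (λ {k} → p∣⇒·≡0 {k})
    where
    open ≡-Reasoning
    -- The exponent is generalised so that it can be split as `suc n` while the field stays indexed
    -- by the original `p`.
    aux : ∀ p → Prime p → (∀ {k} → p ∣ k → ∀ z → k · z ≡ 0#) → (x + y) ^ p ≡ x ^ p + y ^ p
    aux zero    ()
    aux (suc n) pr p∣⇒0 = begin
      (x + y) ^ suc n                           ≡⟨ ^≡ (x + y) (suc n) ⟩
      Exp._^_ semiring (x + y) (suc n)          ≡⟨ Binomial.theorem commutativeSemiring (suc n) x y ⟩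
      term Fin.zero + sum (term ∘ Fin.suc)      ≡⟨ cong (term Fin.zero +_) (sum-init-last (term ∘ Fin.suc)) ⟩
      term Fin.zero + (sum (λ i → term (Fin.suc (inject₁ i))) + term (Fin.suc (fromℕ n)))
        ≡⟨ cong₂ _+_ first (cong₂ _+_ middle final) ⟩
      y ^ suc n + (0# + x ^ suc n)              ≡⟨ cong (y ^ suc n +_) (+-identityˡ _) ⟩
      y ^ suc n + x ^ suc n                     ≡⟨ +-comm _ _ ⟩
      x ^ suc n + y ^ suc n                     ∎
      where
      open Sum semiring
      term = BinomialTerms.binomialTerm semiring x y (suc n)
      first : term Fin.zero ≡ y ^ suc n
      first = trans (+-identityʳ _) (trans (*-identityˡ _) (sym (^≡ y (suc n))))
      middle : sum (λ i → term (Fin.suc (inject₁ i))) ≡ 0#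
      middle = trans (sum-cong-≗ (λ i → p∣⇒0 (prime∣C pr (s≤s z≤n)
                 (s≤s (subst (_< n) (sym (Finₚ.toℕ-inject₁ i)) (Finₚ.toℕ<n i)))) _)) (sum-replicate-zero n)
      final : term (Fin.suc (fromℕ n)) ≡ x ^ suc n
      final rewrite Finₚ.toℕ-fromℕ n | nCn≡1 (suc n) | ℕₚ.n∸n≡0 n =
        trans (+-identityʳ _) (trans (*-identityʳ _) (sym (^≡ x (suc n))))

  frobenius^-additive : ∀ j → Additive (_^ (p ℕ.^ j))
  frobenius^-additive zero    x y = trans (*-identityʳ _) (cong₂ _+_ (sym (*-identityʳ x)) (sym (*-identityʳ y)))
  frobenius^-additive (suc j) x y = begin
    (x + y) ^ (p ℕ.* p ℕ.^ j)                          ≡⟨ ^-assocʳ (x + y) p (p ℕ.^ j) ⟨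
    ((x + y) ^ p) ^ (p ℕ.^ j)                          ≡⟨ cong (_^ (p ℕ.^ j)) (frobenius-additive x y) ⟩
    (x ^ p + y ^ p) ^ (p ℕ.^ j)                        ≡⟨ frobenius^-additive j _ _ ⟩
    (x ^ p) ^ (p ℕ.^ j) + (y ^ p) ^ (p ℕ.^ j)          ≡⟨ cong₂ _+_ (^-assocʳ x p _) (^-assocʳ y p _) ⟩
    x ^ (p ℕ.* p ℕ.^ j) + y ^ (p ℕ.* p ℕ.^ j)          ∎
    where open ≡-Reasoning

  L : (ℕ → Carrier) → Carrier → Carrier
  L = linearized p m

  L-additive : ∀ c → Additive (L c)
  L-additive c x y = trans
    (sumF-cong m (λ {j} _ → trans (cong (c j *_) (frobenius^-additive j x y)) (distribˡ (c j) _ _)))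
    (sumF-+ m _ _)

  -- Linear algebra over the prime field.

  open import Data.List.Membership.DecPropositional _≟_ using (_∈?_)

  1<p : 1 < p
  1<p = ℕ.nonTrivial⇒n>1 p {{prime⇒nonTrivial pr}}

  instance
    p≢0 : NonZero p
    p≢0 = ℕ.>-nonZero (ℕₚ.<-trans (s≤s z≤n) 1<p)

  -- Multiplication by naturals stands in for the scalar action of the prime field.
  lin : ∀ {k} → Vec ℕ k → Vec Carrier k → Carrier
  lin []       []       = 0#
  lin (c ∷ cs) (x ∷ xs) = c · x + lin cs xs

  lin-+ : ∀ {k} cs ds (v : Vec Carrier k) → lin (Vec.zipWith ℕ._+_ cs ds) v ≡ lin cs v + lin ds v
  lin-+ []       []       []      = sym (+-identityˡ 0#)
  lin-+ (c ∷ cs) (d ∷ ds) (x ∷ v) = trans (cong₂ _+_ (·-homo-+ x c d) (lin-+ cs ds v)) (+-interchange (c · x) (d · x) _ _)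

  ·-0# : ∀ a → a · 0# ≡ 0#
  ·-0# zero    = refl
  ·-0# (suc a) = trans (+-identityˡ _) (·-0# a)

  lin-· : ∀ {k} a cs (v : Vec Carrier k) → lin (Vec.map (a ℕ.*_) cs) v ≡ a · lin cs v
  lin-· a []       []      = sym (·-0# a)
  lin-· a (c ∷ cs) (x ∷ v) = trans (cong₂ _+_ (sym (·-assocˡ x a c)) (lin-· a cs v)) (sym (·-distrib-+ (c · x) (lin cs v) a))

  additive-lin : ∀ {f} → Additive f → ∀ {k} cs (v : Vec Carrier k) → f (lin cs v) ≡ lin cs (Vec.map f v)
  additive-lin add []       []      = additive-0 add
  additive-lin {f} add (c ∷ cs) (x ∷ v) = trans (add (c · x) (lin cs v)) (cong₂ _+_ (additive-· add c x) (additive-lin add cs v))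

  Span : ∀ {k} → Vec Carrier k → Carrier → Set
  Span v x = ∃ λ cs → lin cs v ≡ x

  -- This recursive form of linear independence lets tuples be built and counted one entry at a
  -- time.
  Independent : ∀ {k} → Vec Carrier k → Set
  Independent []      = ⊤
  Independent (x ∷ v) = ¬ Span v x × Independent v

  span-+ : ∀ {k} {v : Vec Carrier k} {x y} → Span v x → Span v y → Span v (x + y)
  span-+ {v = v} (cs , refl) (ds , refl) = Vec.zipWith ℕ._+_ cs ds , lin-+ cs ds v

  span-· : ∀ {k} {v : Vec Carrier k} a {x} → Span v x → Span v (a · x)
  span-· {v = v} a (cs , refl) = Vec.map (a ℕ.*_) cs , lin-· a cs v

  p·≡0 : ∀ x → p · x ≡ 0#
  p·≡0 = p∣⇒·≡0 (divides 1 (sym (ℕₚ.*-identityˡ p)))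

  -- Negation is multiplication by `p - 1`, because `p · x` vanishes.
  span-neg : ∀ {k} {v : Vec Carrier k} {x} → Span v x → Span v (- x)
  span-neg {v = v} {x} s = subst (Span v) (+-inverseʳ-unique x (ℕ.pred p · x)
    (trans (cong (_· x) (ℕₚ.suc-pred p)) (p·≡0 x))) (span-· (ℕ.pred p) s)

  -- A Bézout coefficient `j` inverts `a` modulo `p` up to sign: `j · (a · x)` is `x` in the first
  -- case and `- x` in the second.
  span-divide : ∀ {k} {v : Vec Carrier k} {a x} → 0 < a → a < p → Span v (a · x) → Span v x
  span-divide {v = v} {a} {x} 0<a a<p s
    with coprime-Bézout (prime⇒coprime pr {{ℕ.>-nonZero 0<a}} a<p)
  ... | Bézout.-+ i j 1+ip≡ja = subst (Span v) eq (span-· j s)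
    where
    open ≡-Reasoning
    eq : j · (a · x) ≡ x
    eq = begin
      j · (a · x)               ≡⟨ ·-assocˡ x j a ⟩
      (j ℕ.* a) · x             ≡⟨ cong (_· x) 1+ip≡ja ⟨
      x + (i ℕ.* p) · x         ≡⟨ cong (x +_) (p∣⇒·≡0 (divides i refl) x) ⟩
      x + 0#                    ≡⟨ +-identityʳ x ⟩
      x                         ∎
  ... | Bézout.+- i j 1+ja≡ip = subst (Span v) eq (span-neg (span-· j s))
    where
    open ≡-Reasoning
    eq : - (j · (a · x)) ≡ x
    eq = sym (+-inverseʳ-unique (j · (a · x)) x (begin
      j · (a · x) + x          ≡⟨ +-comm _ x ⟩
      x + j · (a · x)          ≡⟨ cong (x +_) (·-assocˡ x j a) ⟩
      x + (j ℕ.* a) · x        ≡⟨ cong (_· x) 1+ja≡ip ⟩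
      (i ℕ.* p) · x            ≡⟨ p∣⇒·≡0 (divides i refl) x ⟩
      0#                       ∎))

  -- Subtracting the two sides would put `(b ∸ a) · x` in the span with `0 < b ∸ a < p`, and
  -- dividing would put `x` there.
  span-separated : ∀ {k} {v : Vec Carrier k} {x a b y z} → ¬ Span v x → a < b → b < p →
                   Span v y → Span v z → a · x + y ≢ b · x + z
  span-separated {v = v} {x} {a} {b} {y} {z} x∉ a<b b<p y∈ z∈ e =
    x∉ (span-divide (ℕₚ.m<n⇒0<n∸m a<b) (ℕₚ.≤-<-trans (ℕₚ.m∸n≤m b a) b<p) (subst (Span v) (sym eq) (span-+ y∈ (span-neg z∈))))
    where
    open ≡-Reasoning
    d = b ℕ.∸ a
    y≡ : y ≡ d · x + z
    y≡ = +-cancelˡ (a · x) _ _ (begin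
      a · x + y                ≡⟨ e ⟩
      b · x + z                ≡⟨ cong (λ c → c · x + z) (ℕₚ.m+[n∸m]≡n (ℕₚ.<⇒≤ a<b)) ⟨
      (a ℕ.+ d) · x + z        ≡⟨ cong (_+ z) (·-homo-+ x a d) ⟩
      (a · x + d · x) + z      ≡⟨ +-assoc _ _ _ ⟩
      a · x + (d · x + z)      ∎)
    eq : d · x ≡ y + - z
    eq = begin
      d · x                    ≡⟨ +-identityʳ _ ⟨
      d · x + 0#               ≡⟨ cong (d · x +_) (-‿inverseʳ z) ⟨
      d · x + (z + - z)        ≡⟨ +-assoc _ _ _ ⟨
      (d · x + z) + - z        ≡⟨ cong (_+ - z) y≡ ⟨
      y + - z                  ∎

  combination : ∀ {k} → Vec Carrier k → Vec (Fin p) k → Carrier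
  combination v cs = lin (Vec.map toℕ cs) v

  -- At the first position where the digits differ, `span-separated` contradicts independence.
  combination-injective : ∀ {k} {v : Vec Carrier k} → Independent v →
                          ∀ {cs ds} → combination v cs ≡ combination v ds → cs ≡ ds
  combination-injective {v = []} _ {[]} {[]} e = refl
  combination-injective {v = x ∷ v} (x∉ , ind) {c ∷ cs} {d ∷ ds} e with ℕₚ.<-cmp (toℕ c) (toℕ d)
  ... | tri< c<d _ _ = ⊥-elim (span-separated x∉ c<d (Finₚ.toℕ<n d) (Vec.map toℕ cs , refl) (Vec.map toℕ ds , refl) e)
  ... | tri> _ _ d<c = ⊥-elim (span-separated x∉ d<c (Finₚ.toℕ<n c) (Vec.map toℕ ds , refl) (Vec.map toℕ cs , refl) (sym e))
  ... | tri≈ _ c≡d _ with Finₚ.toℕ-injective c≡d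
  ... | refl = cong (c ∷_) (combination-injective ind (+-cancelˡ (toℕ c · x) _ _ e))

  spanned : ∀ {k} → Vec Carrier k → List Carrier
  spanned {k} v = map (combination v) (vecs (allFin p) k)

  length-spanned : ∀ {k} (v : Vec Carrier k) → length (spanned v) ≡ p ℕ.^ k
  length-spanned {k} v = trans (List.length-map _ (vecs (allFin p) k))
    (trans (length-vecs (allFin p) k) (cong (ℕ._^ k) (List.length-tabulate {n = p} (λ i → i))))

  allFin-enumerates : Enumerates (allFin p)
  allFin-enumerates = Unique.allFin⁺ p , ∈-allFin

  spanned-unique : ∀ {k} {v : Vec Carrier k} → Independent v → Unique (spanned v)
  spanned-unique {k} ind = Unique.map⁺ (combination-injective ind) (proj₁ (vecs-enumerates allFin-enumerates k))

  ∈-spanned⁻ : ∀ {k} {v : Vec Carrier k} {x} → x ∈ spanned v → Span v x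
  ∈-spanned⁻ x∈ = let cs , _ , eq = ∈-map⁻ _ x∈ in Vec.map toℕ cs , sym eq

  -- Natural coefficients may be reduced modulo `p`, since multiples of `p` annihilate the field.
  ∈-spanned⁺ : ∀ {k} {v : Vec Carrier k} {x} → Span v x → x ∈ spanned v
  ∈-spanned⁺ {k} {v} (cs , refl) = subst (_∈ spanned v) (reduces cs v)
    (∈-map⁺ (combination v) (proj₂ (vecs-enumerates allFin-enumerates k) (Vec.map reduce cs)))
    where
    reduce : ℕ → Fin p
    reduce c = Fin.fromℕ< (m%n<n c p)
    reduce-· : ∀ c x → toℕ (reduce c) · x ≡ c · x
    reduce-· c x = begin
      toℕ (reduce c) · x                           ≡⟨ cong (_· x) (Finₚ.toℕ-fromℕ< (m%n<n c p)) ⟩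
      (c ℕ.% p) · x                                ≡⟨ +-identityʳ _ ⟨
      (c ℕ.% p) · x + 0#                           ≡⟨ cong ((c ℕ.% p) · x +_) (p∣⇒·≡0 (divides (c ℕ./ p) refl) x) ⟨
      (c ℕ.% p) · x + (c ℕ./ p ℕ.* p) · x          ≡⟨ ·-homo-+ x (c ℕ.% p) _ ⟨
      (c ℕ.% p ℕ.+ c ℕ./ p ℕ.* p) · x              ≡⟨ cong (_· x) (m≡m%n+[m/n]*n c p) ⟨
      c · x                                        ∎
      where open ≡-Reasoning
    reduces : ∀ {k} cs (v : Vec Carrier k) → combination v (Vec.map reduce cs) ≡ lin cs v
    reduces []       []      = refl
    reduces (c ∷ cs) (x ∷ v) = cong₂ _+_ (reduce-· c x) (reduces cs v)

  -- Counting independent tuples; bases.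

  outside : ∀ {k} → Vec Carrier k → List Carrier
  outside v = filter (λ x → ¬? (x ∈? spanned v)) elems

  independents : ∀ k → List (Vec Carrier k)
  independents zero    = [] ∷ []
  independents (suc k) = concatMap (λ v → map (_∷ v) (outside v)) (independents k)

  ∈-independents⁻ : ∀ {k} {v : Vec Carrier k} → v ∈ independents k → Independent v
  ∈-independents⁻ {zero} {[]} _ = tt
  ∈-independents⁻ {suc k} v∈ with find (∈-concatMap⁻ (λ v → map (_∷ v) (outside v)) {xs = independents k} v∈)
  ... | w , w∈ , v∈′ with ∈-map⁻ (_∷ w) v∈′
  ... | x , x∈ , refl = proj₂ (∈-filter⁻ (λ x → ¬? (x ∈? spanned w)) {xs = elems} x∈) ∘ ∈-spanned⁺ , ∈-independents⁻ w∈

  ∈-independents⁺ : ∀ {k} {v : Vec Carrier k} → Independent v → v ∈ independents k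
  ∈-independents⁺ {v = []}    _           = here refl
  ∈-independents⁺ {v = x ∷ v} (x∉ , ind) = ∈-concatMap⁺ (λ v → map (_∷ v) (outside v)) (lose (∈-independents⁺ ind)
    (∈-map⁺ (_∷ v) (∈-filter⁺ (λ x → ¬? (x ∈? spanned v)) (proj₂ elems-enumerates x) (x∉ ∘ ∈-spanned⁻))))

  independents-unique : ∀ k → Unique (independents k)
  independents-unique zero    = [] ∷ []
  independents-unique (suc k) = Unique.concat⁺
    (Allₚ.map⁺ (All.tabulate λ _ → Unique.map⁺ Vecₚ.∷-injectiveˡ (Unique.filter⁺ _ (proj₁ elems-enumerates))))
    (AllPairs-map⁺ disjoint (independents-unique k))
    where
    disjoint : ∀ {v w} → v ∈ independents k → w ∈ independents k → v ≢ w →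
               Disjoint (map (_∷ v) (outside v)) (map (_∷ w) (outside w))
    disjoint {v} {w} _ _ v≢w (u∈v , u∈w) with ∈-map⁻ (_∷ v) u∈v | ∈-map⁻ (_∷ w) u∈w
    ... | _ , _ , refl | _ , _ , eq = v≢w (Vecₚ.∷-injectiveʳ eq)

  -- An independent `k`-tuple spans exactly `p ^ k` elements, and each element outside the span
  -- gives one extension.
  length-independents : ∀ k → length (independents k) ≡ prod k (λ i → p ℕ.^ m ℕ.∸ p ℕ.^ i)
  length-independents zero    = refl
  length-independents (suc k) = trans (length-concatMap (λ v → map (_∷ v) (outside v)) (independents k) extensions)
    (cong (ℕ._* (p ℕ.^ m ℕ.∸ p ℕ.^ k)) (length-independents k))
    where
    extensions : ∀ {v} → v ∈ independents k → length (map (_∷ v) (outside v)) ≡ p ℕ.^ m ℕ.∸ p ℕ.^ k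
    extensions {v} v∈ = trans (List.length-map (_∷ v) (outside v))
      (trans (length-filter-∉ _≟_ elems-enumerates (spanned-unique (∈-independents⁻ v∈)))
             (cong₂ ℕ._∸_ length-elems (length-spanned v)))

  -- Existence by counting: every factor `p ^ m ∸ p ^ i` with `i < m` is positive, so the list of
  -- independent `m`-tuples is not empty.
  basis : ∃ λ (e : Vec Carrier m) → Independent e
  basis = nonempty (independents m) (λ v∈ → _ , ∈-independents⁻ v∈)
    (subst (0 <_) (sym (length-independents m)) (prod>0 m _ (λ i<m → ℕₚ.m<n⇒0<n∸m (ℕₚ.^-monoʳ-< p 1<p i<m))))
    where
    nonempty : ∀ {A B : Set} (xs : List A) → (∀ {x} → x ∈ xs → B) → 0 < length xs → B
    nonempty (x ∷ xs) h _ = h (here refl)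

  -- There are q - p^m = 0 ways to extend an independent m-tuple.
  independent⇒spans : ∀ {v : Vec Carrier m} → Independent v → ∀ x → Span v x
  independent⇒spans {v} ind x with x ∈? spanned v
  ... | yes x∈ = ∈-spanned⁻ x∈
  ... | no  x∉ = ⊥-elim (empty none (∈-independents⁺ {v = x ∷ v} (x∉ ∘ ∈-spanned⁺ , ind)))
    where
    count = prod m (λ i → p ℕ.^ m ℕ.∸ p ℕ.^ i)
    none : length (independents (suc m)) ≡ 0
    none = trans (length-independents (suc m))
      (trans (cong (count ℕ.*_) (ℕₚ.n∸n≡0 (p ℕ.^ m))) (ℕₚ.*-zeroʳ count))
    empty : ∀ {A : Set} {xs : List A} {x} → length xs ≡ 0 → x ∉ xs
    empty {xs = []} _ ()

  additive-ext : ∀ {f g} {e : Vec Carrier m} → Additive f → Additive g → Independent e →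
                 Vec.map f e ≡ Vec.map g e → ∀ x → f x ≡ g x
  additive-ext {f} {g} {e} addf addg ind eq x with independent⇒spans ind x
  ... | cs , refl = trans (additive-lin addf cs e) (trans (cong (lin cs) eq) (sym (additive-lin addg cs e)))

  injective⇒independent : ∀ {f} → Additive f → (∀ x y → f x ≡ f y → x ≡ y) →
                          ∀ {k} {v : Vec Carrier k} → Independent v → Independent (Vec.map f v)
  injective⇒independent add inj {v = []}    _          = tt
  injective⇒independent add inj {v = x ∷ v} (x∉ , ind) =
    (λ (cs , e) → x∉ (cs , inj _ _ (trans (additive-lin add cs v) e))) , injective⇒independent add inj ind

  -- The image contains the span of the independent `m`-tuple of values, which is the whole field.
  independent⇒permutation : ∀ {f} → Additive f → ∀ {e : Vec Carrier m} → Independent (Vec.map f e) → IsPermutation f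
  independent⇒permutation add {e} ind = surjective⇒permutation λ y →
    let cs , eq = independent⇒spans ind y in lin cs e , trans (additive-lin add cs e) eq

  -- Power maps with exponent coprime to `q - 1`, and the Costas property.

  q n : ℕ
  q = p ℕ.^ m
  n = q ℕ.∸ 1

  1<q : 1 < q
  1<q = ℕₚ.^-monoʳ-< p 1<p (ℕ.>-nonZero⁻¹ m)

  instance
    n≢0 : NonZero n
    n≢0 = ℕ.>-nonZero (ℕₚ.m<n⇒0<n∸m 1<q)

  q≡1+n : q ≡ suc n
  q≡1+n = sym (ℕₚ.m+[n∸m]≡n (ℕₚ.<⇒≤ 1<q))

  open Residues n
  open Orbits p m n 1<p q≡1+n hiding (p≢0)

  ≤n⇒<q : ∀ {a} → a ≤ n → a < q
  ≤n⇒<q a≤n = subst (_ <_) (sym q≡1+n) (s≤s a≤n)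

  nonzero-^-% : ∀ {x} → x ≢ 0# → ∀ a → x ^ a ≡ x ^ (a ℕ.% n)
  nonzero-^-% {x} x≢0 a = begin
    x ^ a                                    ≡⟨ cong (x ^_) (m≡m%n+[m/n]*n a n) ⟩
    x ^ (a ℕ.% n ℕ.+ a ℕ./ n ℕ.* n)          ≡⟨ ^-homo-* x (a ℕ.% n) _ ⟩
    x ^ (a ℕ.% n) * x ^ (a ℕ./ n ℕ.* n)      ≡⟨ cong (λ b → x ^ (a ℕ.% n) * x ^ b) (ℕₚ.*-comm (a ℕ./ n) n) ⟩
    x ^ (a ℕ.% n) * x ^ (n ℕ.* (a ℕ./ n))    ≡⟨ cong (x ^ (a ℕ.% n) *_) (^-assocʳ x n _) ⟨
    x ^ (a ℕ.% n) * (x ^ n) ^ (a ℕ./ n)      ≡⟨ cong (λ y → x ^ (a ℕ.% n) * y ^ (a ℕ./ n)) (fermat x≢0) ⟩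
    x ^ (a ℕ.% n) * 1# ^ (a ℕ./ n)           ≡⟨ cong (x ^ (a ℕ.% n) *_) (1^ (a ℕ./ n)) ⟩
    x ^ (a ℕ.% n) * 1#                       ≡⟨ *-identityʳ _ ⟩
    x ^ (a ℕ.% n)                            ∎
    where open ≡-Reasoning

  -- Fermat's theorem settles nonzero `x`; at zero both powers vanish because both exponents are
  -- positive.
  ^-≡ₙ : ∀ {a b} → 0 < a → 0 < b → a ≡ₙ b → ∀ x → x ^ a ≡ x ^ b
  ^-≡ₙ {a} {b} 0<a 0<b e x with x ≟ 0#
  ... | yes refl = trans (0^ 0<a) (sym (0^ 0<b))
  ... | no  x≢0  = trans (nonzero-^-% x≢0 a) (trans (cong (x ^_) e) (sym (nonzero-^-% x≢0 b)))

  ^-bezout : ∀ {w a b} i j → w ^ a ≡ 1# → w ^ b ≡ 1# → 1 ℕ.+ j ℕ.* b ≡ i ℕ.* a → w ≡ 1#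
  ^-bezout {w} {a} {b} i j wᵃ wᵇ eq = begin
    w                      ≡⟨ *-identityʳ w ⟨
    w * 1#                 ≡⟨ cong (w *_) (multiple b j wᵇ) ⟨
    w ^ (1 ℕ.+ j ℕ.* b)    ≡⟨ cong (w ^_) eq ⟩
    w ^ (i ℕ.* a)          ≡⟨ multiple a i wᵃ ⟩
    1#                     ∎
    where
    open ≡-Reasoning
    multiple : ∀ a i → w ^ a ≡ 1# → w ^ (i ℕ.* a) ≡ 1#
    multiple a i e = trans (cong (w ^_) (ℕₚ.*-comm i a)) (trans (sym (^-assocʳ w a i)) (trans (cong (_^ i) e) (1^ i)))

  -- Bézout writes 1 as a difference of multiples of `s` and `n`, and both `w ^ s` and `w ^ n` are
  -- 1.
  coprime-root≡1 : ∀ {s w} → Coprime s n → w ≢ 0# → w ^ s ≡ 1# → w ≡ 1#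
  coprime-root≡1 {s} {w} cop w≢0 wˢ≡1 with coprime-Bézout cop
  ... | Bézout.+- x y eq = ^-bezout x y wˢ≡1 (fermat w≢0) eq
  ... | Bézout.-+ x y eq = ^-bezout y x (fermat w≢0) wˢ≡1 eq

  -- For nonzero arguments the ratio of `x` and `y` is an `s`-th root of 1, hence 1.
  ^-injective : ∀ {s} → 0 < s → Coprime s n → ∀ {x y} → x ^ s ≡ y ^ s → x ≡ y
  ^-injective {s} 0<s cop {x} {y} e with x ≟ 0# | y ≟ 0#
  ... | yes refl | yes refl = refl
  ... | yes refl | no y≢0   = ⊥-elim (^-nonzero s y≢0 (trans (sym e) (0^ 0<s)))
  ... | no x≢0   | yes refl = ⊥-elim (^-nonzero s x≢0 (trans e (0^ 0<s)))
  ... | no x≢0   | no y≢0   = begin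
    x                ≡⟨ *-identityʳ x ⟨
    x * 1#           ≡⟨ cong (x *_) yy⁻¹≡1 ⟨
    x * (y * y⁻¹)    ≡⟨ cong (x *_) (*-comm y y⁻¹) ⟩
    x * (y⁻¹ * y)    ≡⟨ *-assoc x y⁻¹ y ⟨
    x * y⁻¹ * y      ≡⟨ cong (_* y) (coprime-root≡1 cop (*-nonzero x≢0 y⁻¹≢0) ratioˢ≡1) ⟩
    1# * y           ≡⟨ *-identityˡ y ⟩
    y                ∎
    where
    open ≡-Reasoning
    y⁻¹ = proj₁ (inverse y y≢0)
    yy⁻¹≡1 : y * y⁻¹ ≡ 1#
    yy⁻¹≡1 = proj₂ (inverse y y≢0)
    y⁻¹≢0 : y⁻¹ ≢ 0#
    y⁻¹≢0 z = 0≢1 (trans (sym (zeroʳ y)) (trans (cong (y *_) (sym z)) yy⁻¹≡1))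
    ratioˢ≡1 : (x * y⁻¹) ^ s ≡ 1#
    ratioˢ≡1 = begin
      (x * y⁻¹) ^ s       ≡⟨ ^-distrib-* x y⁻¹ s ⟩
      x ^ s * y⁻¹ ^ s     ≡⟨ cong (_* y⁻¹ ^ s) e ⟩
      y ^ s * y⁻¹ ^ s     ≡⟨ ^-distrib-* y y⁻¹ s ⟨
      (y * y⁻¹) ^ s       ≡⟨ cong (_^ s) yy⁻¹≡1 ⟩
      1# ^ s              ≡⟨ 1^ s ⟩
      1#                  ∎

  ^-permutation : ∀ {s} → 0 < s → Coprime s n → IsPermutation (_^ s)
  ^-permutation 0<s cop = injective⇒permutation (^-injective 0<s cop)

  costas : ∀ {s f} → 0 < s → Coprime s n → Additive f → (∀ x y → f x ≡ f y → x ≡ y) → IsCostas (λ x → f (x ^ s))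
  costas {s} {f} 0<s cop add inj = trans (cong f (0^ 0<s)) (additive-0 add) , difference
    where
    open ≡-Reasoning
    difference : ∀ d → d ≢ 1# → IsPermutation (λ x → f ((d * x) ^ s) - f (x ^ s))
    difference d d≢1 = injective⇒permutation λ {x} {y} e →
      ^-injective 0<s cop (*-cancelˡ c≢0 (inj _ _ (trans (sym (rewritten x)) (trans e (rewritten y)))))
      where
      -- The difference equals `f (c * x ^ s)`, a composition of injective maps once `c` is nonzero;
      -- and `d ^ s ≡ 1# ^ s` would give `d ≡ 1#`.
      c = d ^ s - 1#
      c≢0 : c ≢ 0#
      c≢0 e = d≢1 (^-injective 0<s cop (trans (+-cancelʳ (- 1#) _ _ (trans e (sym (-‿inverseʳ 1#)))) (sym (1^ s))))
      rewritten : ∀ x → f ((d * x) ^ s) - f (x ^ s) ≡ f (c * x ^ s)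
      rewritten x = begin
        f ((d * x) ^ s) - f (x ^ s)            ≡⟨ additive-- add _ _ ⟨
        f ((d * x) ^ s - x ^ s)                ≡⟨ cong (λ y → f (y - x ^ s)) (^-distrib-* d x s) ⟩
        f (d ^ s * x ^ s - x ^ s)              ≡⟨ cong (λ y → f (d ^ s * x ^ s + y)) (trans (cong -_ (sym (*-identityˡ (x ^ s)))) (-‿distribˡ-* 1# (x ^ s))) ⟩
        f (d ^ s * x ^ s + - 1# * x ^ s)       ≡⟨ cong f (distribʳ (x ^ s) (d ^ s) (- 1#)) ⟨
        f (c * x ^ s)                          ∎

  -- Additive maps as linearized polynomials.

  e : Vec Carrier m
  e = proj₁ basis

  e-independent : Independent e
  e-independent = proj₂ basis

  nth : ∀ {k} → Vec Carrier k → ℕ → Carrier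
  nth []      _       = 0#
  nth (c ∷ _) zero    = c
  nth (_ ∷ v) (suc j) = nth v j

  nth-injective : ∀ {k} {v w : Vec Carrier k} → (∀ {j} → j < k → nth v j ≡ nth w j) → v ≡ w
  nth-injective {v = []}    {[]}    h = refl
  nth-injective {v = _ ∷ _} {_ ∷ _} h = cong₂ _∷_ (h (s≤s z≤n)) (nth-injective (h ∘ s≤s))

  -- The exponents `p ^ j` with `j < m` are distinct and below `q`, so the coefficients can be
  -- compared.
  L-coefficients-unique : ∀ b c → (∀ x → L b x ≡ L c x) → ∀ {j} → j < m → b j ≡ c j
  L-coefficients-unique b c h {j} j<m = begin
    b j                                  ≡⟨ spread-injective m (p ℕ.^_) b (λ _ _ → p^-injective) j<m ⟨
    spread m (p ℕ.^_) b (p ℕ.^ j)        ≡⟨ coefficients-unique _ _ same (p^<q j<m) ⟩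
    spread m (p ℕ.^_) c (p ℕ.^ j)        ≡⟨ spread-injective m (p ℕ.^_) c (λ _ _ → p^-injective) j<m ⟩
    c j                                  ∎
    where
    open ≡-Reasoning
    p^<q : ∀ {j} → j < m → p ℕ.^ j < q
    p^<q j<m = ℕₚ.^-monoʳ-< p 1<p j<m
    same : ∀ x → sumF q (λ i → spread m (p ℕ.^_) b i * x ^ i) ≡ sumF q (λ i → spread m (p ℕ.^_) c i * x ^ i)
    same x = trans (sumF-spread m (p ℕ.^_) b p^<q x) (trans (h x) (sym (sumF-spread m (p ℕ.^_) c p^<q x)))

  images : Vec Carrier m → Vec Carrier m
  images c = Vec.map (L (nth c)) e

  -- Injective since an additive map is determined on the basis and L_c determines c;
  -- hence, by finiteness, every additive map is linearized.
  images-injective : ∀ {b c} → images b ≡ images c → b ≡ c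
  images-injective {b} {c} eq = nth-injective (L-coefficients-unique (nth b) (nth c)
    (additive-ext (L-additive (nth b)) (L-additive (nth c)) e-independent eq))

  images-surjective : ∀ v → ∃ λ c → images c ≡ v
  images-surjective = injective⇒surjective (Vecₚ.≡-dec _≟_) (vecs-enumerates elems-enumerates m) images-injective

  -- The linearized polynomial with prescribed values v on the basis.
  coefficients : Vec Carrier m → ℕ → Carrier
  coefficients v = nth (proj₁ (images-surjective v))

  ⟦_⟧ : Vec Carrier m → Carrier → Carrier
  ⟦ v ⟧ = L (coefficients v)

  ⟦⟧-basis : ∀ v → Vec.map ⟦ v ⟧ e ≡ v
  ⟦⟧-basis v = proj₂ (images-surjective v)

  ⟦⟧-additive : ∀ v → Additive ⟦ v ⟧
  ⟦⟧-additive v = L-additive (coefficients v)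

  -- Every additive map is linearized: the two sides are additive and agree on the basis.
  ⟦⟧-interpolates : ∀ {f} → Additive f → ∀ x → f x ≡ ⟦ Vec.map f e ⟧ x
  ⟦⟧-interpolates add = additive-ext add (⟦⟧-additive _) e-independent (sym (⟦⟧-basis _))

  ⟦⟧-permutation : ∀ {v} → Independent v → IsPermutation ⟦ v ⟧
  ⟦⟧-permutation ind = independent⇒permutation (⟦⟧-additive _) {e} (subst Independent (sym (⟦⟧-basis _)) ind)

  -- The list of Costas maps: membership, distinctness, completeness and length.

  power-then-L : ∀ b r x → L b (x ^ r) ≡ sumF m (λ j → b j * x ^ (r ℕ.* p ℕ.^ j))
  power-then-L b r x = sumF-cong m (λ {j} _ → cong (b j *_) (^-assocʳ x r (p ℕ.^ j)))

  -- The first component is an exponent, one for each orbit; the second is the image of the basis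
  -- under the linearized permutation.
  parameters : List (ℕ × Vec Carrier m)
  parameters = cartesianProduct reps (independents m)

  costasMap : ℕ × Vec Carrier m → Carrier → Carrier
  costasMap (r , v) x = ⟦ v ⟧ (x ^ r)

  costasMaps : List (Carrier → Carrier)
  costasMaps = map costasMap parameters

  costasMaps-costas : All (IsCostasLinOfPower p m) costasMaps
  costasMaps-costas = Allₚ.map⁺ (All.tabulate holds)
    where
    holds : ∀ {rv} → rv ∈ parameters → IsCostasLinOfPower p m (costasMap rv)
    holds {r , v} rv∈ =
      let r∈ , v∈ = ∈-cartesianProduct⁻ reps (independents m) rv∈
          0<r , _ , cop = ∈-units⁻ (reps⊆units r∈)
          perm = ⟦⟧-permutation (∈-independents⁻ v∈)
      in costas 0<r cop (⟦⟧-additive v) (proj₁ perm) ,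
         coefficients v , r , perm , 0<r , coprime⇒gcd≡1 cop , λ _ → refl

  -- The map `h`, the inverse of `⟦ w ⟧` after `⟦ v ⟧`, is additive and hence linearized. So
  -- `x ^ s = h (x ^ r)` is a combination of powers `x ^ (r p^j)`, one of which must be `x ^ s`.
  equal-maps⇒~ : ∀ {r s v w} → 0 < r → 0 < s → s ≤ n → IsPermutation ⟦ w ⟧ →
                 (∀ x → ⟦ v ⟧ (x ^ r) ≡ ⟦ w ⟧ (x ^ s)) → r ~ s
  equal-maps⇒~ {r} {s} {v} {w} 0<r 0<s s≤n (inj , sur) same =
    let j , j<m , eq = monomial≡sparse s m exponent b (≤n⇒<q s≤n) (λ {j} _ → ≤n⇒<q (red≤n (r ℕ.* p ℕ.^ j))) expansion
    in j , j<m , trans (sym (red-≡ₙ (r ℕ.* p ℕ.^ j))) (cong (ℕ._% n) eq)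
    where
    open ≡-Reasoning
    exponent : ℕ → ℕ
    -- Reduction brings the exponents below `q`, where coefficients can be compared, and keeps them
    -- positive, so the powers also agree at zero.
    exponent j = red (r ℕ.* p ℕ.^ j)
    h : Carrier → Carrier
    h x = proj₁ (sur (⟦ v ⟧ x))
    ⟦w⟧∘h : ∀ x → ⟦ w ⟧ (h x) ≡ ⟦ v ⟧ x
    ⟦w⟧∘h x = proj₂ (sur (⟦ v ⟧ x))
    h-additive : Additive h
    h-additive x y = inj _ _ (begin
      ⟦ w ⟧ (h (x + y))              ≡⟨ ⟦w⟧∘h (x + y) ⟩
      ⟦ v ⟧ (x + y)                  ≡⟨ ⟦⟧-additive v x y ⟩
      ⟦ v ⟧ x + ⟦ v ⟧ y              ≡⟨ cong₂ _+_ (⟦w⟧∘h x) (⟦w⟧∘h y) ⟨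
      ⟦ w ⟧ (h x) + ⟦ w ⟧ (h y)      ≡⟨ ⟦⟧-additive w (h x) (h y) ⟨
      ⟦ w ⟧ (h x + h y)              ∎)
    b = coefficients (Vec.map h e)
    expansion : ∀ x → x ^ s ≡ sumF m (λ j → b j * x ^ exponent j)
    expansion x = begin
      x ^ s                                               ≡⟨ inj _ _ (trans (sym (same x)) (sym (⟦w⟧∘h (x ^ r)))) ⟩
      h (x ^ r)                                           ≡⟨ ⟦⟧-interpolates h-additive (x ^ r) ⟩
      L b (x ^ r)                                         ≡⟨ power-then-L b r x ⟩
      sumF m (λ j → b j * x ^ (r ℕ.* p ℕ.^ j))            ≡⟨ sumF-cong m (λ {j} _ → cong (b j *_)
                                                               (^-≡ₙ (ℕₚ.*-mono-≤ 0<r (ℕₚ.m^n>0 p j)) (0<red (r ℕ.* p ℕ.^ j)) (sym (red-≡ₙ (r ℕ.* p ℕ.^ j))) x)) ⟩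
      sumF m (λ j → b j * x ^ exponent j)                 ∎

  -- Equal maps have related exponents, hence the same representative `r`. As `x ^ r` is onto, the
  -- additive parts agree, and their values on the basis are `v` and `w`.
  costasMaps-distinct : AllPairs (λ f g → ¬ (∀ x → f x ≡ g x)) costasMaps
  costasMaps-distinct = AllPairs-map⁺ distinct (Unique.cartesianProduct⁺ reps-unique (independents-unique m))
    where
    distinct : ∀ {rv sw} → rv ∈ parameters → sw ∈ parameters → rv ≢ sw →
               ¬ (∀ x → costasMap rv x ≡ costasMap sw x)
    distinct {r , v} {s , w} rv∈ sw∈ rv≢sw same = rv≢sw (cong₂ _,_ r≡s v≡w)
      where
      r∈ : r ∈ reps
      r∈ = proj₁ (∈-cartesianProduct⁻ reps (independents m) rv∈)
      s∈ : s ∈ reps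
      s∈ = proj₁ (∈-cartesianProduct⁻ reps (independents m) sw∈)
      w∈ : w ∈ independents m
      w∈ = proj₂ (∈-cartesianProduct⁻ reps (independents m) sw∈)
      r-unit : 0 < r × r ≤ n × Coprime r n
      r-unit = ∈-units⁻ (reps⊆units r∈)
      s-unit : 0 < s × s ≤ n × Coprime s n
      s-unit = ∈-units⁻ (reps⊆units s∈)
      r≡s : r ≡ s
      r≡s = reps-≡ r∈ s∈ (equal-maps⇒~ {r} {s} {v} {w} (proj₁ r-unit) (proj₁ s-unit) (proj₁ (proj₂ s-unit))
              (⟦⟧-permutation (∈-independents⁻ w∈)) same)
      same′ : ∀ y → ⟦ v ⟧ y ≡ ⟦ w ⟧ y
      same′ y =
        let x , xʳ≡y = proj₂ (^-permutation (proj₁ r-unit) (proj₂ (proj₂ r-unit))) y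
        in trans (cong ⟦ v ⟧ (sym xʳ≡y)) (trans (same x) (cong ⟦ w ⟧ (trans (cong (x ^_) (sym r≡s)) xʳ≡y)))
      v≡w : v ≡ w
      v≡w = trans (sym (⟦⟧-basis v)) (trans (Vecₚ.map-cong same′ e) (⟦⟧-basis w))

  -- L(x^s) = (L ∘ Frobᵏ)(x^r) where s ≡ r pᵏ.
  costasMaps-complete : ∀ f → IsCostasLinOfPower p m f → Any (λ g → ∀ x → f x ≡ g x) costasMaps
  costasMaps-complete f (_ , c , s , (inj , _) , 0<s , gcd≡1 , f≡) =
    lose (∈-map⁺ costasMap (∈-cartesianProduct⁺ r∈ (∈-independents⁺ independent))) agree
    where
    open ≡-Reasoning
    rep = reps-complete (gcd≡1⇒coprime gcd≡1)
    r = proj₁ rep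
    r∈ = proj₁ (proj₂ rep)
    k = proj₁ (proj₂ (proj₂ rep))
    rpᵏ≡ₙs = proj₂ (proj₂ (proj₂ (proj₂ rep)))
    h : Carrier → Carrier
    h x = L c (x ^ (p ℕ.^ k))
    h-additive : Additive h
    h-additive x y = trans (cong (L c) (frobenius^-additive k x y)) (L-additive c _ _)
    independent : Independent (Vec.map h e)
    independent = injective⇒independent h-additive
      -- The factor `x ^ (p ^ k)` of `h` is injective because `p ^ k` is coprime to `n`.
      (λ x y eq → ^-injective (ℕₚ.m^n>0 p k) (coprime-p^ k) (inj _ _ eq)) e-independent
    agree : ∀ x → f x ≡ costasMap (r , Vec.map h e) x
    agree x = begin
      f x                          ≡⟨ f≡ x ⟩
      L c (x ^ s)                  ≡⟨ cong (L c) (^-≡ₙ 0<s (ℕₚ.*-mono-≤ (proj₁ (∈-units⁻ (reps⊆units r∈))) (ℕₚ.m^n>0 p k)) (sym rpᵏ≡ₙs) x) ⟩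
      L c (x ^ (r ℕ.* p ℕ.^ k))    ≡⟨ cong (L c) (^-assocʳ x r (p ℕ.^ k)) ⟨
      h (x ^ r)                    ≡⟨ ⟦⟧-interpolates h-additive (x ^ r) ⟩
      ⟦ Vec.map h e ⟧ (x ^ r)      ∎

  length-costasMaps : length costasMaps ≡ (φ n ℕ./ m) ℕ.* prod m (λ k → p ℕ.^ m ℕ.∸ p ℕ.^ k)
  length-costasMaps = trans (List.length-map costasMap parameters)
    (trans (length-cartesianProductWith _,_ reps (independents m)) (cong₂ ℕ._*_ length-reps (length-independents m)))

open import Data.Nat using (_^_; _*_; _∸_; _/_)

theorem6p1 : (p m : ℕ) → Prime p → .{{_ : NonZero m}} → (F : FiniteField (p ^ m)) →
    let open FiniteField F using (Carrier) renaming (IsCostasLinOfPower to CL) in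
    Σ (List (Carrier → Carrier)) λ fs →
    All (CL p m) fs ×
    AllPairs (λ f g → ¬ (∀ x → f x ≡ g x)) fs ×
    (∀ f → CL p m f → Any (λ g → ∀ x → f x ≡ g x) fs) ×
    (length fs ≡ (φ (p ^ m ∸ 1) / m) * prod m (λ k → p ^ m ∸ p ^ k))
theorem6p1 p m pr F =
  C.costasMaps , C.costasMaps-costas , C.costasMaps-distinct , C.costasMaps-complete , C.length-costasMaps
  where module C = Costas p m pr F
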